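{- Let $q$ be a prime power, $t\ge1$ and $n\ge1$. The Möbius number $\mu(B_n^{(t)}(q))$ equals $(-1)^{n-2}W_n^{(t)}(q)$, where \[W_n^{(t)}(q)=\sum_{(\sigma_1,\ldots,\sigma_t)}\prod_{i=1}^tq^{\mathrm{inv}(\sigma_i)},\] the sum ranging over all $t$-tuples $(\sigma_1,\ldots,\sigma_t)$ of permutations in $\mathfrak{S}_n$ with no common ascent.
   Context: $B_n(q)$ is the lattice of subspaces of $\mathbb{F}_q^n$ ordered by inclusion. For $t\ge2$, $B_n^{(t)}(q)$ is the subposet of $B_n(q)\times\cdots\times B_n(q)$ ($t$ factors, componentwise order) of $t$-tuples of subspaces of equal dimension; $B_n^{(1)}(q)=B_n(q)$. The Möbius number is $\mu(\hat0,\hat1)$. $\mathrm{inv}(\sigma)$ is the number of pairs $i<j$ with $\sigma(i)>\sigma(j)$; an ascent of $\sigma$ is $i\in[n-1]$ with $\sigma(i)<\sigma(i+1)$, and a common ascent of a $t$-tuple is an index that is an ascent of every entry. -}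

module Defs where

open import Data.Bool using (Bool; true; false; _∧_; _∨_; not; if_then_else_)
open import Data.Nat as ℕ using (ℕ; zero; suc)
open import Data.Fin as Fin using (Fin; toℕ)
open import Data.Fin.Properties using () renaming (_≟_ to _≟ᶠ_)
open import Data.Integer as ℤ using (ℤ; 0ℤ; 1ℤ)
open import Data.List as List using (List; []; _∷_; filter; map; concatMap; allFin; length)
open import Data.Vec as Vec using (Vec; []; _∷_; lookup; zipWith; replicate)
open import Data.Product using (∃)
open import Relation.Binary.PropositionalEquality using (_≡_; _≢_)
open import Relation.Nullary.Decidable using (⌊_⌋)
open import Algebra.Structures using (IsCommutativeRing)

allL : {A : Set} → (A → Bool) → List A → Bool
allL p []       = true
allL p (x ∷ xs) = p x ∧ allL p xs

anyL : {A : Set} → (A → Bool) → List A → Bool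
anyL p []       = false
anyL p (x ∷ xs) = p x ∨ anyL p xs

_⇒ᵇ_ : Bool → Bool → Bool
a ⇒ᵇ b = not a ∨ b

allVecs : {A : Set} → List A → (n : ℕ) → List (Vec A n)
allVecs xs zero    = [] ∷ []
allVecs xs (suc n) = concatMap (λ x → map (x ∷_) (allVecs xs n)) xs

allV : {A : Set} {n : ℕ} → (A → Bool) → Vec A n → Bool
allV p []       = true
allV p (x ∷ xs) = p x ∧ allV p xs

sumℕ : List ℕ → ℕ
sumℕ = List.foldr ℕ._+_ 0

sumℤ : List ℤ → ℤ
sumℤ = List.foldr ℤ._+_ 0ℤ

prodVℕ : {n : ℕ} → Vec ℕ n → ℕ
prodVℕ = Vec.foldr _ ℕ._*_ 1

countL : {A : Set} → (A → Bool) → List A → ℕ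
countL p xs = length (filter (λ x → Data.Bool._≟_ (p x) true) xs)
  where import Data.Bool

-- Möbius function of a finite poset given by an explicit list of its
-- elements and a (decidable, Bool-valued) partial order.
--   μ(x,y) = 1 if x = y,  μ(x,y) = - Σ_{x ≤ z < y} μ(x,z) if x < y,
--   μ(x,y) = 0 otherwise.
-- Recursion is structured with fuel; fuel = number of elements suffices
-- (every strictly descending step in y shortens a chain in the poset).

module Möbius {A : Set} (elems : List A) (_≤ᵇ_ : A → A → Bool) where

  _<ᵇ_ : A → A → Bool
  x <ᵇ y = (x ≤ᵇ y) ∧ not (y ≤ᵇ x)

  μ-fuel : ℕ → A → A → ℤ
  μ-fuel zero    x y = 0ℤ
  μ-fuel (suc k) x y =
    if x ≤ᵇ y
    then (if y ≤ᵇ x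
          then 1ℤ
          else ℤ.- sumℤ (map (μ-fuel k x)
                            (filter (λ z → Data.Bool._≟_ ((x ≤ᵇ z) ∧ (z <ᵇ y)) true) elems)))
    else 0ℤ
    where import Data.Bool

  μ : A → A → ℤ
  μ = μ-fuel (length elems)

record FiniteField (q : ℕ) : Set where
  field
    _+_ _*_    : Fin q → Fin q → Fin q
    -_         : Fin q → Fin q
    0# 1#      : Fin q
    isCommRing : IsCommutativeRing _≡_ _+_ _*_ -_ 0# 1#
    0≢1        : 0# ≢ 1#
    inverse    : ∀ x → x ≢ 0# → ∃ λ y → x * y ≡ 1#

module LinAlg {q : ℕ} (F : FiniteField q) where
  open FiniteField F

  _==ᶠ_ : Fin q → Fin q → Bool
  a ==ᶠ b = ⌊ a ≟ᶠ b ⌋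

  _==ᵛ_ : {n : ℕ} → Vec (Fin q) n → Vec (Fin q) n → Bool
  u ==ᵛ v = allV (λ b → b) (zipWith _==ᶠ_ u v)

  scalars : List (Fin q)
  scalars = allFin q

  vecs : (n : ℕ) → List (Vec (Fin q) n)
  vecs n = allVecs scalars n

  zeroV : {n : ℕ} → Vec (Fin q) n
  zeroV = replicate _ 0#

  _⊕_ : {n : ℕ} → Vec (Fin q) n → Vec (Fin q) n → Vec (Fin q) n
  _⊕_ = zipWith _+_

  _·_ : {n : ℕ} → Fin q → Vec (Fin q) n → Vec (Fin q) n
  c · v = Vec.map (c *_) v

  lincomb : {n k : ℕ} → Vec (Fin q) k → Vec (Vec (Fin q) n) k → Vec (Fin q) n
  lincomb []       []       = zeroV
  lincomb (c ∷ cs) (v ∷ vs) = (c · v) ⊕ lincomb cs vs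

  SubsetV : ℕ → Set
  SubsetV n = Vec (Fin q) n → Bool

  -- Enumeration of all subsets of F^n (each exactly once, up to
  -- extensional equality) via nested tables indexed by coordinates.
  Table : ℕ → Set
  Table zero    = Bool
  Table (suc n) = Vec (Table n) q

  member : {n : ℕ} → Table n → SubsetV n
  member b []       = b
  member T (x ∷ v)  = member (lookup T x) v

  allTables : (n : ℕ) → List (Table n)
  allTables zero    = true ∷ false ∷ []
  allTables (suc n) = allVecs (allTables n) q

  allSubsets : (n : ℕ) → List (SubsetV n)
  allSubsets n = map member (allTables n)

  _⊆ᵇ_ : {n : ℕ} → SubsetV n → SubsetV n → Bool
  _⊆ᵇ_ {n} S T = allL (λ v → S v ⇒ᵇ T v) (vecs n)

  isSubspace : {n : ℕ} → SubsetV n → Bool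
  isSubspace {n} S =
    S zeroV
    ∧ allL (λ u → allL (λ v → (S u ∧ S v) ⇒ᵇ S (u ⊕ v)) (vecs n)) (vecs n)
    ∧ allL (λ c → allL (λ v → S v ⇒ᵇ S (c · v)) (vecs n)) scalars

  independent : {n k : ℕ} → Vec (Vec (Fin q) n) k → Bool
  independent {n} {k} vs =
    allL (λ c → (lincomb c vs ==ᵛ zeroV) ⇒ᵇ (c ==ᵛ zeroV)) (vecs k)

  spans : {n k : ℕ} → Vec (Vec (Fin q) n) k → SubsetV n → Bool
  spans {n} {k} vs S =
    allL (λ v → S v ⇒ᵇ anyL (λ c → lincomb c vs ==ᵛ v) (vecs k)) (vecs n)

  hasDim : {n : ℕ} → SubsetV n → ℕ → Bool
  hasDim {n} S k =
    anyL (λ vs → allV S vs ∧ independent vs ∧ spans vs S) (allVecs (vecs n) k)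

  upTo : ℕ → List ℕ
  upTo n = List.upTo (suc n)

  -- The poset B_n^{(t)}(q): t-tuples of subspaces of F^n of equal
  -- dimension, ordered componentwise by inclusion.  (For t = 1 this is
  -- B_n(q), the 1-tuples being identified with subspaces.)

  Elem : ℕ → ℕ → Set
  Elem n t = Vec (SubsetV n) t

  isElem : {n t : ℕ} → Elem n t → Bool
  isElem {n} Ss = allV isSubspace Ss ∧ anyL (λ k → allV (λ S → hasDim S k) Ss) (upTo n)

  elems : (n t : ℕ) → List (Elem n t)
  elems n t = filter (λ Ss → Data.Bool._≟_ (isElem Ss) true) (allVecs (allSubsets n) t)
    where import Data.Bool

  _≤ᴮ_ : {n t : ℕ} → Elem n t → Elem n t → Bool
  Ss ≤ᴮ Ts = allV (λ b → b) (zipWith _⊆ᵇ_ Ss Ts)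

  bottom : (n t : ℕ) → Elem n t
  bottom n t = replicate t (λ v → v ==ᵛ zeroV)

  top : (n t : ℕ) → Elem n t
  top n t = replicate t (λ _ → true)

  möbiusNumber : (n t : ℕ) → ℤ
  möbiusNumber n t = Möbius.μ (elems n t) _≤ᴮ_ (bottom n t) (top n t)

injectiveᵇ : {n : ℕ} → Vec (Fin n) n → Bool
injectiveᵇ {n} σ =
  allL (λ i → allL (λ j → ⌊ i ≟ᶠ j ⌋ ∨ not ⌊ lookup σ i ≟ᶠ lookup σ j ⌋) (allFin n)) (allFin n)

perms : (n : ℕ) → List (Vec (Fin n) n)
perms n = filter (λ σ → Data.Bool._≟_ (injectiveᵇ σ) true) (allVecs (allFin n) n)
  where import Data.Bool

_<ᶠ_ : {n : ℕ} → Fin n → Fin n → Bool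
i <ᶠ j = ⌊ toℕ i ℕ.<? toℕ j ⌋

inv : {n : ℕ} → Vec (Fin n) n → ℕ
inv {n} σ =
  sumℕ (map (λ i → countL (λ j → (i <ᶠ j) ∧ (lookup σ j <ᶠ lookup σ i)) (allFin n)) (allFin n))

consecutive : {n : ℕ} → Fin n → Fin n → Bool
consecutive i j = ⌊ toℕ j ℕ.≟ suc (toℕ i) ⌋

ascentAt : {n : ℕ} → Vec (Fin n) n → Fin n → Fin n → Bool
ascentAt σ i j = consecutive i j ∧ (lookup σ i <ᶠ lookup σ j)

hasCommonAscent : {n t : ℕ} → Vec (Vec (Fin n) n) t → Bool
hasCommonAscent {n} σs =
  anyL (λ i → anyL (λ j → consecutive i j ∧ allV (λ σ → ascentAt σ i j) σs) (allFin n)) (allFin n)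

W : (n t q : ℕ) → ℕ
W n t q =
  sumℕ (map (λ σs → prodVℕ (Vec.map (λ σ → q ℕ.^ inv σ) σs))
            (filter (λ σs → Data.Bool._≟_ (hasCommonAscent σs) false) (allVecs (perms n) t)))
  where import Data.Bool

{-# OPTIONS --safe #-}

-- Everything is reduced to the recurrence Σⱼ (-1)ʲ [n, j]ᵗ Wⱼ = 0 (n ≥ 1), [n, j] a Gaussian binomial.
-- On the Möbius side it is the defining recursion: by double counting of pairs (subspace, basis), every
-- d-dimensional subspace contains [d, j] subspaces of dimension j, so by induction μ(0̂, y) depends only
-- on the dimension of y.
-- On the permutation side, write σ as its Lehmer code c, cᵢ = #{j > i : σⱼ < σᵢ}. Then inv σ = Σ cᵢ and i
-- is an ascent iff cᵢ ≤ cᵢ₊₁. Growing the code to the left, [n, j] is the generating function of the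
-- increasing extensions by n - j entries, so [n, j]ᵗ Wⱼ is the weight of the t-tuples of codes with no
-- common ascent within the last j entries and only common ascents within the first n - j. Splitting by
-- whether the position where the two parts meet is a common ascent makes the alternating sum telescope.
module Submission where

open import Defs
open import Algebra.Bundles using (CommutativeRing)
open import Algebra.Properties.CommutativeSemigroup using (interchange)
import Algebra.Properties.Ring
open import Data.Bool as Bool using (Bool; true; false; _∧_; _∨_; not)
import Data.Bool.Properties as Boolₚ
open import Data.Empty using (⊥-elim)
open import Data.Fin using (Fin; zero; suc; toℕ; punchIn)
open import Data.Fin.Properties as Finₚ using (toℕ<n; punchIn-injective; punchInᵢ≢i) renaming (_≟_ to _≟ᶠ_)
open import Data.Integer as ℤ using (ℤ; 0ℤ; 1ℤ; -1ℤ; _+_; _*_; -_; _-_; +_; _^_)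
import Data.Integer.Properties as ℤₚ
open import Data.Integer.Tactic.RingSolver using (solve-∀)
open import Data.List as List using (List; []; _∷_; _++_; filter; map; concatMap; allFin; length; upTo)
open import Data.List.Membership.Propositional using (_∈_; lose)
open import Data.List.Membership.Propositional.Properties using (∈-map⁺; ∈-concatMap⁺; ∈-allFin; ∈-upTo⁺)
import Data.List.Properties as Listₚ
open import Data.List.Properties using (map-∘; map-cong; map-tabulate; map-upTo; upTo-∷ʳ)
open import Data.List.Relation.Unary.Any using (here; there)
open import Data.Nat as ℕ using (ℕ; zero; suc; _≤_; _<_; z≤n; s≤s)
import Data.Nat.Properties as ℕₚ
open import Data.Product using (∃; _×_; _,_; proj₁; proj₂)
open import Data.Sum using (inj₁; inj₂)
open import Data.Unit using (⊤; tt)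
open import Data.Vec as Vec using (Vec; []; _∷_; lookup; zipWith; replicate)
import Data.Vec.Properties as Vecₚ
open import Function using (_∘_; id)
open import Relation.Binary.PropositionalEquality
open import Relation.Nullary using (¬_; yes; no; contradiction)
open import Relation.Nullary.Decidable using (⌊_⌋; isYes≗does; dec-true)
open ≡-Reasoning

-- Gaussian binomials enter in two forms, as sums over weakly decreasing chains and as numbers of
-- subspaces. The bridge is `frames d j`, the product of the `q ^ d - q ^ i` for `i < j`: both
-- forms, multiplied by `frames j j`, give `frames d j`, and `frames j j` is nonzero because
-- `q > 1`. Differences and signs are why all sums are taken in ℤ. Subsets are Boolean functions,
-- which propositional equality does not compare by their values. Bijections therefore appear as
-- equalities of sums against arbitrary summands, sets as 0/1 indicators under a sum, and dimension
-- as cardinality `q ^ d`; monotonicity and uniqueness of dimension then become arithmetic of powers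
-- of `q`. The Möbius function runs on fuel, the number of elements of the poset. A call on an
-- element of dimension `d` is evaluated with more than `d` units, so it has to be shown that the
-- poset has more than `n` elements; each of the dimensions 0 to `n` supplies at least one.

private variable
  A C D : Set
  m n t : ℕ

-- Boolean tests and their logical meaning

∧-true : {a b : Bool} → a ∧ b ≡ true → a ≡ true × b ≡ true
∧-true {true} {true} _ = refl , refl

∧-intro : {a b : Bool} → a ≡ true → b ≡ true → a ∧ b ≡ true
∧-intro refl refl = refl

⇒ᵇ-elim : {a b : Bool} → a ⇒ᵇ b ≡ true → a ≡ true → b ≡ true
⇒ᵇ-elim {true} {true} _ _ = refl

⇒ᵇ-intro : {a b : Bool} → (a ≡ true → b ≡ true) → a ⇒ᵇ b ≡ true
⇒ᵇ-intro {false} _ = refl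
⇒ᵇ-intro {true}  f = f refl

not-intro : {b : Bool} → ¬ b ≡ true → not b ≡ true
not-intro {false} _ = refl
not-intro {true}  f = ⊥-elim (f refl)

not-elim : {b : Bool} → not b ≡ true → ¬ b ≡ true
not-elim {false} _ ()

bool-ext : {a b : Bool} → (a ≡ true → b ≡ true) → (b ≡ true → a ≡ true) → a ≡ b
bool-ext {false} {false} _ _ = refl
bool-ext {true}  {true}  _ _ = refl
bool-ext {false} {true}  _ g = g refl
bool-ext {true}  {false} f _ = sym (f refl)

allL-elim : {p : A → Bool} {xs : List A} → allL p xs ≡ true → ∀ {x} → x ∈ xs → p x ≡ true
allL-elim e (here refl) = proj₁ (∧-true e)
allL-elim e (there x∈)  = allL-elim (proj₂ (∧-true e)) x∈

allL-intro : {p : A → Bool} (xs : List A) → (∀ x → p x ≡ true) → allL p xs ≡ true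
allL-intro []       f = refl
allL-intro (x ∷ xs) f = ∧-intro (f x) (allL-intro xs f)

anyL-elim : {p : A → Bool} (xs : List A) → anyL p xs ≡ true → ∃ λ x → p x ≡ true
anyL-elim {p = p} (x ∷ xs) e with p x in eq
... | true  = x , eq
... | false = anyL-elim xs e

anyL-intro : {p : A → Bool} {xs : List A} {x : A} → x ∈ xs → p x ≡ true → anyL p xs ≡ true
anyL-intro {p = p} {xs = y ∷ xs} (here refl) e rewrite e = refl
anyL-intro {p = p} {xs = y ∷ xs} (there x∈) e with p y
... | true  = refl
... | false = anyL-intro x∈ e

allV-elim : {p : A → Bool} (v : Vec A n) → allV p v ≡ true → ∀ i → p (lookup v i) ≡ true
allV-elim (x ∷ v) e zero    = proj₁ (∧-true e)
allV-elim (x ∷ v) e (suc i) = allV-elim v (proj₂ (∧-true e)) i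

allV-intro : {p : A → Bool} (v : Vec A n) → (∀ i → p (lookup v i) ≡ true) → allV p v ≡ true
allV-intro []      f = refl
allV-intro (x ∷ v) f = ∧-intro (f zero) (allV-intro v (f ∘ suc))

∈-allVecs : {xs : List A} → (∀ x → x ∈ xs) → ∀ {n} (v : Vec A n) → v ∈ allVecs xs n
∈-allVecs all []      = here refl
∈-allVecs {xs = xs} all {suc n} (x ∷ v) =
  ∈-concatMap⁺ (λ y → map (y ∷_) (allVecs xs n)) (lose (all x) (∈-map⁺ (x ∷_) (∈-allVecs all v)))

pos-^ : ∀ b k → + (b ℕ.^ k) ≡ (+ b) ^ k
pos-^ b zero    = refl
pos-^ b (suc k) = trans (ℤₚ.pos-* b _) (cong ((+ b) *_) (pos-^ b k))

-- Finite sums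

𝟙 : Bool → ℤ
𝟙 true  = 1ℤ
𝟙 false = 0ℤ

∏ : Vec ℤ n → ℤ
∏ []      = 1ℤ
∏ (x ∷ v) = x * ∏ v

𝟙-∧ : ∀ a b → 𝟙 (a ∧ b) ≡ 𝟙 a * 𝟙 b
𝟙-∧ false b = refl
𝟙-∧ true  b = sym (ℤₚ.*-identityˡ (𝟙 b))

-- Under a sum, an equation that holds only for the counted elements is enough.
𝟙-guard : ∀ b {x y} → (b ≡ true → x ≡ y) → 𝟙 b * x ≡ 𝟙 b * y
𝟙-guard true  f = cong (1ℤ *_) (f refl)
𝟙-guard false f = refl

𝟙-allV : (p : A → Bool) (v : Vec A n) → 𝟙 (allV p v) ≡ ∏ (Vec.map (𝟙 ∘ p) v)
𝟙-allV p []      = refl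
𝟙-allV p (x ∷ v) = trans (𝟙-∧ (p x) (allV p v)) (cong (𝟙 (p x) *_) (𝟙-allV p v))

𝟙-allV-zipWith : (p : A → C → Bool) (u : Vec A n) (v : Vec C n) →
  𝟙 (allV id (zipWith p u v)) ≡ ∏ (zipWith (λ x y → 𝟙 (p x y)) u v)
𝟙-allV-zipWith p []      []      = refl
𝟙-allV-zipWith p (x ∷ u) (y ∷ v) =
  trans (𝟙-∧ (p x y) (allV id (zipWith p u v))) (cong (𝟙 (p x y) *_) (𝟙-allV-zipWith p u v))

-- Opaque, so that unification recovers the summand from a sum.
opaque

  ∑ : List A → (A → ℤ) → ℤ
  ∑ xs f = sumℤ (map f xs)

  ∑-sumℤ : (xs : List A) (f : A → ℤ) → sumℤ (map f xs) ≡ ∑ xs f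
  ∑-sumℤ xs f = refl

  ∑-[] : (f : A → ℤ) → ∑ [] f ≡ 0ℤ
  ∑-[] f = refl

  ∑-∷ : (x : A) (xs : List A) (f : A → ℤ) → ∑ (x ∷ xs) f ≡ f x + ∑ xs f
  ∑-∷ x xs f = refl

  ∑-singleton : (x : A) (f : A → ℤ) → ∑ (x ∷ []) f ≡ f x
  ∑-singleton x f = ℤₚ.+-identityʳ (f x)

  ∑-cong : (xs : List A) {f g : A → ℤ} → (∀ x → f x ≡ g x) → ∑ xs f ≡ ∑ xs g
  ∑-cong xs e = cong sumℤ (map-cong e xs)

  ∑-zero : (xs : List A) → ∑ xs (λ _ → 0ℤ) ≡ 0ℤ
  ∑-zero []       = refl
  ∑-zero (x ∷ xs) = trans (ℤₚ.+-identityˡ _) (∑-zero xs)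

  ∑-+ : (xs : List A) (f g : A → ℤ) → ∑ xs (λ x → f x + g x) ≡ ∑ xs f + ∑ xs g
  ∑-+ []       f g = refl
  ∑-+ (x ∷ xs) f g = trans (cong (_+_ (f x + g x)) (∑-+ xs f g))
    (interchange ℤₚ.+-commutativeSemigroup (f x) (g x) (∑ xs f) (∑ xs g))

  ∑-*ˡ : (xs : List A) (c : ℤ) (f : A → ℤ) → ∑ xs (λ x → c * f x) ≡ c * ∑ xs f
  ∑-*ˡ []       c f = sym (ℤₚ.*-zeroʳ c)
  ∑-*ˡ (x ∷ xs) c f = trans (cong (_+_ (c * f x)) (∑-*ˡ xs c f)) (sym (ℤₚ.*-distribˡ-+ c (f x) (∑ xs f)))

  ∑-*ʳ : (xs : List A) (f : A → ℤ) (c : ℤ) → ∑ xs (λ x → f x * c) ≡ ∑ xs f * c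
  ∑-*ʳ xs f c = trans (∑-cong xs (λ x → ℤₚ.*-comm (f x) c))
    (trans (∑-*ˡ xs c f) (ℤₚ.*-comm c (∑ xs f)))

  ∑-swap : (xs : List A) (ys : List C) (f : A → C → ℤ) →
    ∑ xs (λ x → ∑ ys (f x)) ≡ ∑ ys (λ y → ∑ xs (λ x → f x y))
  ∑-swap []       ys f = sym (∑-zero ys)
  ∑-swap (x ∷ xs) ys f = trans (cong (_+_ (∑ ys (f x))) (∑-swap xs ys f))
    (sym (∑-+ ys (f x) (λ y → ∑ xs (λ x₁ → f x₁ y))))

  ∑-++ : (xs ys : List A) (f : A → ℤ) → ∑ (xs ++ ys) f ≡ ∑ xs f + ∑ ys f
  ∑-++ []       ys f = sym (ℤₚ.+-identityˡ _)
  ∑-++ (x ∷ xs) ys f = trans (cong (_+_ (f x)) (∑-++ xs ys f)) (sym (ℤₚ.+-assoc (f x) _ _))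

  ∑-map : (g : C → A) (xs : List C) (f : A → ℤ) → ∑ (map g xs) f ≡ ∑ xs (f ∘ g)
  ∑-map g xs f = cong sumℤ (sym (map-∘ xs))

  ∑-concatMap : (g : C → List A) (xs : List C) (f : A → ℤ) →
    ∑ (concatMap g xs) f ≡ ∑ xs (λ x → ∑ (g x) f)
  ∑-concatMap g []       f = refl
  ∑-concatMap g (x ∷ xs) f =
    trans (∑-++ (g x) (concatMap g xs) f) (cong (_+_ (∑ (g x) f)) (∑-concatMap g xs f))

  ∑-filter : (p : A → Bool) (b : Bool) (xs : List A) (f : A → ℤ) →
    ∑ (filter (λ x → p x Bool.≟ b) xs) f ≡ ∑ xs (λ x → 𝟙 ⌊ p x Bool.≟ b ⌋ * f x)
  ∑-filter p b []       f = refl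
  ∑-filter p b (x ∷ xs) f with p x Bool.≟ b
  ... | yes _ = cong₂ _+_ (sym (ℤₚ.*-identityˡ (f x))) (∑-filter p b xs f)
  ... | no _  = trans (∑-filter p b xs f) (sym (ℤₚ.+-identityˡ _))

  ≟-true : ∀ b → ⌊ b Bool.≟ true ⌋ ≡ b
  ≟-true true  = refl
  ≟-true false = refl

  ≟-false : ∀ b → ⌊ b Bool.≟ false ⌋ ≡ not b
  ≟-false true  = refl
  ≟-false false = refl

  ∑-filter-true : (p : A → Bool) (xs : List A) (f : A → ℤ) →
    ∑ (filter (λ x → p x Bool.≟ true) xs) f ≡ ∑ xs (λ x → 𝟙 (p x) * f x)
  ∑-filter-true p xs f = trans (∑-filter p true xs f)
    (∑-cong xs (λ x → cong (λ b → 𝟙 b * f x) (≟-true (p x))))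

  ∑-length : (xs : List A) → ∑ xs (λ _ → 1ℤ) ≡ + length xs
  ∑-length []       = refl
  ∑-length (x ∷ xs) = cong (_+_ 1ℤ) (∑-length xs)

  countL-∑ : (p : A → Bool) (xs : List A) → + countL p xs ≡ ∑ xs (𝟙 ∘ p)
  countL-∑ p xs = trans (sym (∑-length (filter (λ x → p x Bool.≟ true) xs)))
    (trans (∑-filter-true p xs _) (∑-cong xs (λ x → ℤₚ.*-identityʳ (𝟙 (p x)))))

  sumℕ-∑ : (xs : List A) (f : A → ℕ) → + sumℕ (map f xs) ≡ ∑ xs (λ x → + f x)
  sumℕ-∑ []       f = refl
  sumℕ-∑ (x ∷ xs) f = trans (ℤₚ.pos-+ (f x) _) (cong (_+_ (+ f x)) (sumℕ-∑ xs f))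

  ∑-allFin : (n : ℕ) (f : Fin (suc n) → ℤ) →
    ∑ (allFin (suc n)) f ≡ f zero + ∑ (allFin n) (f ∘ suc)
  ∑-allFin n f = trans (cong (λ xs → f zero + ∑ xs f) (sym (map-tabulate id suc)))
    (cong (_+_ (f zero)) (∑-map suc (allFin n) f))

  ∑-upTo : (n : ℕ) (f : ℕ → ℤ) → ∑ (upTo (suc n)) f ≡ f 0 + ∑ (upTo n) (f ∘ suc)
  ∑-upTo n f = trans (cong (λ xs → f 0 + ∑ xs f) (sym (map-upTo suc n)))
    (cong (_+_ (f 0)) (∑-map suc (upTo n) f))

∑-allVecs : (xs : List A) (n : ℕ) (f : Vec A (suc n) → ℤ) →
  ∑ (allVecs xs (suc n)) f ≡ ∑ xs (λ x → ∑ (allVecs xs n) (λ v → f (x ∷ v)))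
∑-allVecs xs n f = trans (∑-concatMap (λ x → map (x ∷_) (allVecs xs n)) xs f)
  (∑-cong xs (λ x → ∑-map (x ∷_) (allVecs xs n) f))

-- Distributivity: expanding a product of sums gives a sum over all choices of one summand per
-- factor. This is the source of every power with exponent `t`.
∑-allVecs-∏ : (xs : List A) (g : C → A → ℤ) (ys : Vec C n) →
  ∑ (allVecs xs n) (λ v → ∏ (zipWith g ys v)) ≡ ∏ (Vec.map (λ y → ∑ xs (g y)) ys)
∑-allVecs-∏ xs g []       = ∑-singleton [] _
∑-allVecs-∏ {n = suc n} xs g (y ∷ ys) = begin
  ∑ (allVecs xs (suc n)) (λ v → ∏ (zipWith g (y ∷ ys) v))
    ≡⟨ ∑-allVecs xs n _ ⟩
  ∑ xs (λ x → ∑ (allVecs xs n) (λ v → g y x * ∏ (zipWith g ys v)))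
    ≡⟨ ∑-cong xs (λ x → ∑-*ˡ (allVecs xs n) (g y x) _) ⟩
  ∑ xs (λ x → g y x * ∑ (allVecs xs n) (λ v → ∏ (zipWith g ys v)))
    ≡⟨ ∑-*ʳ xs (g y) _ ⟩
  ∑ xs (g y) * ∑ (allVecs xs n) (λ v → ∏ (zipWith g ys v))
    ≡⟨ cong (∑ xs (g y) *_) (∑-allVecs-∏ xs g ys) ⟩
  ∑ xs (g y) * ∏ (Vec.map (λ y₁ → ∑ xs (g y₁)) ys) ∎

-- The hypothesis, equality of sums against every `f`, plays the role of a bijection `g` between the
-- two lists; their order never matters.
∑-allVecs-transport : {xs : List A} {ys : List C} (g : C → A) →
  (∀ f → ∑ xs f ≡ ∑ ys (f ∘ g)) →
  ∀ n f → ∑ (allVecs xs n) f ≡ ∑ (allVecs ys n) (f ∘ Vec.map g)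
∑-allVecs-transport g e zero    f = trans (∑-singleton [] f) (sym (∑-singleton [] _))
∑-allVecs-transport {xs = xs} {ys} g e (suc n) f = begin
  ∑ (allVecs xs (suc n)) f
    ≡⟨ ∑-allVecs xs n f ⟩
  ∑ xs (λ x → ∑ (allVecs xs n) (λ v → f (x ∷ v)))
    ≡⟨ e _ ⟩
  ∑ ys (λ y → ∑ (allVecs xs n) (λ v → f (g y ∷ v)))
    ≡⟨ ∑-cong ys (λ y → ∑-allVecs-transport g e n (λ v → f (g y ∷ v))) ⟩
  ∑ ys (λ y → ∑ (allVecs ys n) (λ v → f (g y ∷ Vec.map g v)))
    ≡⟨ ∑-allVecs ys n _ ⟨
  ∑ (allVecs ys (suc n)) (f ∘ Vec.map g) ∎

∑-allVecs-singleton : (x : A) (n : ℕ) (f : Vec A n → ℤ) → ∑ (allVecs (x ∷ []) n) f ≡ f (replicate n x)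
∑-allVecs-singleton x zero    f = ∑-singleton [] f
∑-allVecs-singleton x (suc n) f = begin
  ∑ (allVecs (x ∷ []) (suc n)) f
    ≡⟨ ∑-allVecs (x ∷ []) n f ⟩
  ∑ (x ∷ []) (λ y → ∑ (allVecs (x ∷ []) n) (λ v → f (y ∷ v)))
    ≡⟨ ∑-singleton x _ ⟩
  ∑ (allVecs (x ∷ []) n) (λ v → f (x ∷ v))
    ≡⟨ ∑-allVecs-singleton x n _ ⟩
  f (replicate (suc n) x) ∎

∑-allFin-upTo : (n : ℕ) (f : ℕ → ℤ) → ∑ (allFin n) (f ∘ toℕ) ≡ ∑ (upTo n) f
∑-allFin-upTo zero    f = trans (∑-[] _) (sym (∑-[] f))
∑-allFin-upTo (suc n) f = trans (∑-allFin n (f ∘ toℕ))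
  (trans (cong (_+_ (f 0)) (∑-allFin-upTo n (f ∘ suc))) (sym (∑-upTo n f)))


∑-upTo-cong : (n : ℕ) {f g : ℕ → ℤ} → (∀ j → j < n → f j ≡ g j) → ∑ (upTo n) f ≡ ∑ (upTo n) g
∑-upTo-cong zero    e = trans (∑-[] _) (sym (∑-[] _))
∑-upTo-cong (suc n) {f} {g} e = trans (∑-upTo n f)
  (trans (cong₂ _+_ (e 0 (s≤s z≤n)) (∑-upTo-cong n (λ j j<n → e (suc j) (s≤s j<n)))) (sym (∑-upTo n g)))

∑-upTo-zero : (n : ℕ) {f : ℕ → ℤ} → (∀ j → j < n → f j ≡ 0ℤ) → ∑ (upTo n) f ≡ 0ℤ
∑-upTo-zero n e = trans (∑-upTo-cong n e) (∑-zero (upTo n))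

∑-upTo-select : (n : ℕ) {j₀ : ℕ} (f : ℕ → ℤ) → j₀ < n → (∀ j → j ≢ j₀ → f j ≡ 0ℤ) → ∑ (upTo n) f ≡ f j₀
∑-upTo-select (suc n) {zero} f _ e = trans (∑-upTo n f)
  (trans (cong (_+_ (f 0)) (∑-upTo-zero n (λ j _ → e (suc j) (λ ())))) (ℤₚ.+-identityʳ (f 0)))
∑-upTo-select (suc n) {suc j₀} f (s≤s j₀<n) e = trans (∑-upTo n f)
  (trans (cong₂ _+_ (e 0 (λ ())) (∑-upTo-select n (f ∘ suc) j₀<n (λ j j≢ → e (suc j) (j≢ ∘ ℕₚ.suc-injective))))
    (ℤₚ.+-identityˡ (f (suc j₀))))

∑-upTo-lower : (n : ℕ) {f : ℕ → ℤ} → (∀ j → j < n → 1ℤ ℤ.≤ f j) → + n ℤ.≤ ∑ (upTo n) f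
∑-upTo-lower zero    e = ℤₚ.≤-reflexive (sym (∑-[] _))
∑-upTo-lower (suc n) {f} e = ℤₚ.≤-trans
  (ℤₚ.+-mono-≤ (e 0 (s≤s z≤n)) (∑-upTo-lower n (λ j j<n → e (suc j) (s≤s j<n))))
  (ℤₚ.≤-reflexive (sym (∑-upTo n f)))

-- Gaussian binomials

∑-upTo-last : (n : ℕ) (f : ℕ → ℤ) → ∑ (upTo (suc n)) f ≡ ∑ (upTo n) f + f n
∑-upTo-last n f = begin
  ∑ (upTo (suc n)) f             ≡⟨ cong (λ xs → ∑ xs f) (upTo-∷ʳ n) ⟨
  ∑ (upTo n ++ n ∷ []) f         ≡⟨ ∑-++ (upTo n) (n ∷ []) f ⟩
  ∑ (upTo n) f + ∑ (n ∷ []) f    ≡⟨ cong (_+_ (∑ (upTo n) f)) (∑-singleton n f) ⟩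
  ∑ (upTo n) f + f n             ∎

-- Trades the bound `y ≤ x` of a sum for an indicator, so that sums with different bounds get a
-- common range.
∑-upTo-truncate : ∀ {x n} (f : ℕ → ℤ) → x < n →
  ∑ (upTo n) (λ y → 𝟙 (y ℕ.<ᵇ suc x) * f y) ≡ ∑ (upTo (suc x)) f
∑-upTo-truncate {zero} {suc n} f x<n = begin
  ∑ (upTo (suc n)) (λ y → 𝟙 (y ℕ.<ᵇ 1) * f y)
    ≡⟨ ∑-upTo n _ ⟩
  1ℤ * f 0 + ∑ (upTo n) (λ y → 0ℤ * f (suc y))
    ≡⟨ cong₂ _+_ (ℤₚ.*-identityˡ (f 0)) (trans (∑-cong (upTo n) (λ y → ℤₚ.*-zeroˡ (f (suc y)))) (∑-zero (upTo n))) ⟩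
  f 0 + 0ℤ
    ≡⟨ ℤₚ.+-identityʳ (f 0) ⟩
  f 0
    ≡⟨ ∑-singleton 0 f ⟨
  ∑ (upTo 1) f ∎
∑-upTo-truncate {suc x} {suc n} f (s≤s x<n) = trans (∑-upTo n _)
  (trans (cong₂ _+_ (ℤₚ.*-identityˡ (f 0)) (∑-upTo-truncate (f ∘ suc) x<n)) (sym (∑-upTo (suc x) f)))

∏-* : (f g : A → ℤ) (v : Vec A n) →
  ∏ (Vec.map (λ x → f x * g x) v) ≡ ∏ (Vec.map f v) * ∏ (Vec.map g v)
∏-* f g []      = refl
∏-* f g (x ∷ v) = trans (cong (f x * g x *_) (∏-* f g v))
  (interchange ℤₚ.*-commutativeSemigroup (f x) (g x) _ _)

∏-const : {f : A → ℤ} {c : ℤ} (v : Vec A n) → (∀ i → f (lookup v i) ≡ c) → ∏ (Vec.map f v) ≡ c ^ n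
∏-const []      e = refl
∏-const (x ∷ v) e = cong₂ _*_ (e zero) (∏-const v (e ∘ suc))

module Gaussian (q : ℤ) where

  -- The Gaussian binomial [m + k, k], as the generating function of the chains k ≥ y₁ ≥ … ≥ yₘ ≥ 0.
  gauss : ℕ → ℕ → ℤ
  gauss zero    k = 1ℤ
  gauss (suc m) k = ∑ (upTo (suc k)) (λ y → q ^ y * gauss m y)

  -- The product of `q ^ d - q ^ i` over `i < j`: the number of ordered independent `j`-tuples in a
  -- space of dimension `d`.
  frames : ℕ → ℕ → ℤ
  frames d zero    = 1ℤ
  frames d (suc j) = frames d j * (q ^ d - q ^ j)

  -- The factor for `i = 0` is `q ^ suc d - 1`; each of the other `j` factors releases one `q` and
  -- leaves a factor of `frames d j`.
  frames-suc : ∀ d j → frames (suc d) (suc j) ≡ (q ^ suc d - 1ℤ) * q ^ j * frames d j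
  frames-suc d zero = lemma (q * q ^ d)
    where
    lemma : ∀ x → 1ℤ * (x - 1ℤ) ≡ (x - 1ℤ) * 1ℤ * 1ℤ
    lemma = solve-∀
  frames-suc d (suc j) = trans (cong (_* (q ^ suc d - q ^ suc j)) (frames-suc d j))
    (lemma q (q ^ d) (q ^ j) (frames d j))
    where
    lemma : ∀ q u a x → (q * u - 1ℤ) * a * x * (q * u - q * a) ≡ (q * u - 1ℤ) * (q * a) * (x * (u - a))
    lemma = solve-∀

  gauss-zero : ∀ m → gauss m 0 ≡ 1ℤ
  gauss-zero zero    = refl
  gauss-zero (suc m) = trans (∑-singleton 0 _) (trans (ℤₚ.*-identityˡ _) (gauss-zero m))

  -- The product formula for Gaussian binomials, free of division. Splitting off the chains that
  -- start with the largest value `y = suc k` gives the q-Pascal rule, and `frames-suc` puts the two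
  -- resulting terms over a common factor.
  gauss-frames : ∀ m k → gauss m k * frames k k ≡ frames (k ℕ.+ m) k
  gauss-frames zero k =
    trans (ℤₚ.*-identityˡ (frames k k)) (cong (λ d → frames d k) (sym (ℕₚ.+-identityʳ k)))
  gauss-frames (suc m) zero = trans (ℤₚ.*-identityʳ _) (gauss-zero (suc m))
  gauss-frames (suc m) (suc k) = begin
    gauss (suc m) (suc k) * frames (suc k) (suc k)
      ≡⟨ cong₂ _*_ (∑-upTo-last (suc k) _) (frames-suc k k) ⟩
    (gauss (suc m) k + q ^ suc k * gauss m (suc k)) * ((q ^ suc k - 1ℤ) * q ^ k * frames k k)
      ≡⟨ lemma q (q ^ k) (q ^ K) (frames k k) (frames K k) (gauss (suc m) k) (gauss m (suc k))
           (gauss-frames (suc m) k) prev ⟩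
    (q ^ suc K - 1ℤ) * q ^ k * frames K k
      ≡⟨ frames-suc K k ⟨
    frames (suc K) (suc k) ∎
    where
    K : ℕ
    K = k ℕ.+ suc m
    -- By definition `frames K (suc k)` is `frames K k` times `q ^ K - q ^ k`, so both induction
    -- hypotheses become multiples of `frames K k`.
    prev : gauss m (suc k) * ((q ^ suc k - 1ℤ) * q ^ k * frames k k) ≡ frames K k * (q ^ K - q ^ k)
    prev = begin
      gauss m (suc k) * ((q ^ suc k - 1ℤ) * q ^ k * frames k k)
        ≡⟨ cong (gauss m (suc k) *_) (frames-suc k k) ⟨
      gauss m (suc k) * frames (suc k) (suc k)
        ≡⟨ gauss-frames m (suc k) ⟩
      frames (suc k ℕ.+ m) (suc k)
        ≡⟨ cong (λ d → frames d (suc k)) (ℕₚ.+-suc k m) ⟨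
      frames K (suc k) ∎
    lemma : ∀ q a u x y g h → g * x ≡ y → h * ((q * a - 1ℤ) * a * x) ≡ y * (u - a) →
      (g + q * a * h) * ((q * a - 1ℤ) * a * x) ≡ (q * u - 1ℤ) * a * y
    lemma q a u x y g h e₁ e₂ = begin
      (g + q * a * h) * ((q * a - 1ℤ) * a * x)
        ≡⟨ expand q a x g h ⟩
      (q * a - 1ℤ) * a * (g * x) + q * a * (h * ((q * a - 1ℤ) * a * x))
        ≡⟨ cong₂ (λ r s → (q * a - 1ℤ) * a * r + q * a * s) e₁ e₂ ⟩
      (q * a - 1ℤ) * a * y + q * a * (y * (u - a))
        ≡⟨ collect q a u y ⟩
      (q * u - 1ℤ) * a * y ∎
      where
      expand : ∀ q a x g h → (g + q * a * h) * ((q * a - 1ℤ) * a * x)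
        ≡ (q * a - 1ℤ) * a * (g * x) + q * a * (h * ((q * a - 1ℤ) * a * x))
      expand = solve-∀
      collect : ∀ q a u y → (q * a - 1ℤ) * a * y + q * a * (y * (u - a)) ≡ (q * u - 1ℤ) * a * y
      collect = solve-∀

-- Weights of tuples of codes and the telescoping sum

_≤ᵛ_ : Vec (Fin m) t → Vec (Fin n) t → Bool
ys ≤ᵛ xs = allV id (zipWith (λ y x → toℕ y ℕ.<ᵇ suc (toℕ x)) ys xs)

module CodeSums (q : ℤ) (t : ℕ) where
  open Gaussian q

  monomial : Vec (Fin n) t → ℤ
  monomial ys = ∏ (Vec.map (λ y → q ^ toℕ y) ys)

  -- The weight of the t-tuples of permutations of length k + 1 without common ascent
  -- whose Lehmer codes start with the entries ys.
  headed : (k : ℕ) → Vec (Fin (suc k)) t → ℤ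
  headed zero    ys = 1ℤ
  headed (suc k) ys =
    monomial ys * ∑ (allVecs (allFin (suc k)) t) (λ xs → 𝟙 (not (ys ≤ᵛ xs)) * headed k xs)

  -- Becomes `W`; the empty permutation has no first entry, so length 0 is not reached through
  -- `headed`.
  total : ℕ → ℤ
  total zero    = 1ℤ
  total (suc k) = ∑ (allVecs (allFin (suc k)) t) (headed k)

  -- Weight of the ways to put `m` entries in front of codes headed by `xs` so that each new
  -- position is a common ascent. Being an ascent of every code is a separate condition on each
  -- coordinate, hence the product.
  gaussV : ℕ → Vec (Fin n) t → ℤ
  gaussV m xs = ∏ (Vec.map (λ x → gauss m (toℕ x)) xs)

  -- The weight of the t-tuples of length m + (k + 1) whose common ascents are exactly the first m positions.
  mixed : ℕ → ℕ → ℤ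
  mixed k m = ∑ (allVecs (allFin (suc k)) t) (λ xs → headed k xs * gaussV m xs)

  -- Isolates the new entries `ys` adjacent to `xs`: the chain recurrence of `gauss` holds in each
  -- coordinate, and the product of the `t` sums expands into one sum over tuples.
  gaussV-suc : ∀ m (xs : Vec (Fin n) t) → gaussV (suc m) xs ≡
    ∑ (allVecs (allFin (suc n)) t) (λ ys → 𝟙 (ys ≤ᵛ xs) * (monomial ys * gaussV m ys))
  gaussV-suc {n} m xs = begin
    ∏ (Vec.map (λ x → gauss (suc m) (toℕ x)) xs)
      ≡⟨ cong ∏ (Vecₚ.map-cong pointwise xs) ⟩
    ∏ (Vec.map (λ x → ∑ (allFin (suc n)) (summand x)) xs)
      ≡⟨ ∑-allVecs-∏ (allFin (suc n)) summand xs ⟨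
    ∑ (allVecs (allFin (suc n)) t) (λ ys → ∏ (zipWith summand xs ys))
      ≡⟨ ∑-cong (allVecs (allFin (suc n)) t) (factor xs) ⟩
    ∑ (allVecs (allFin (suc n)) t) (λ ys → 𝟙 (ys ≤ᵛ xs) * (monomial ys * gaussV m ys)) ∎
    where
    -- With the bound `y ≤ x` in the indicator, all coordinates sum over `Fin (suc n)`, as the
    -- expansion requires.
    summand : Fin n → Fin (suc n) → ℤ
    summand x y = 𝟙 (toℕ y ℕ.<ᵇ suc (toℕ x)) * (q ^ toℕ y * gauss m (toℕ y))
    pointwise : ∀ x → gauss (suc m) (toℕ x) ≡ ∑ (allFin (suc n)) (summand x)
    pointwise x = trans
      (sym (∑-upTo-truncate (λ y → q ^ y * gauss m y) (ℕₚ.m<n⇒m<1+n (toℕ<n x))))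
      (sym (∑-allFin-upTo (suc n) _))
    factor : ∀ {s} (xs : Vec (Fin n) s) (ys : Vec (Fin (suc n)) s) → ∏ (zipWith summand xs ys) ≡
      𝟙 (ys ≤ᵛ xs) * (∏ (Vec.map (λ y → q ^ toℕ y) ys) * ∏ (Vec.map (λ y → gauss m (toℕ y)) ys))
    factor []       []       = refl
    factor (x ∷ xs) (y ∷ ys) = begin
      summand x y * ∏ (zipWith summand xs ys)
        ≡⟨ cong (summand x y *_) (factor xs ys) ⟩
      𝟙 b * (q ^ toℕ y * gauss m (toℕ y)) * (𝟙 (ys ≤ᵛ xs) * (c * d))
        ≡⟨ lemma (𝟙 b) (q ^ toℕ y) (gauss m (toℕ y)) (𝟙 (ys ≤ᵛ xs)) c d ⟩
      𝟙 b * 𝟙 (ys ≤ᵛ xs) * (q ^ toℕ y * c * (gauss m (toℕ y) * d))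
        ≡⟨ cong (_* (q ^ toℕ y * c * (gauss m (toℕ y) * d))) (𝟙-∧ b (ys ≤ᵛ xs)) ⟨
      𝟙 (b ∧ (ys ≤ᵛ xs)) * (q ^ toℕ y * c * (gauss m (toℕ y) * d)) ∎
      where
      b : Bool
      b = toℕ y ℕ.<ᵇ suc (toℕ x)
      c d : ℤ
      c = ∏ (Vec.map (λ y → q ^ toℕ y) ys)
      d = ∏ (Vec.map (λ y → gauss m (toℕ y)) ys)
      lemma : ∀ b e g b′ c d → b * (e * g) * (b′ * (c * d)) ≡ b * b′ * (e * c * (g * d))
      lemma = solve-∀

  -- The same expansion without a neighbour to compare with: `y ≤ k` is already the range of
  -- `Fin (suc k)`.
  gauss-^ : ∀ m k → gauss (suc m) k ^ t ≡
    ∑ (allVecs (allFin (suc k)) t) (λ ys → monomial ys * gaussV m ys)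
  gauss-^ m k = begin
    gauss (suc m) k ^ t
      ≡⟨ ∏-const units (λ _ → trans (∑-allFin-upTo (suc k) (λ y → q ^ y * gauss m y)) refl) ⟨
    ∏ (Vec.map (λ x → ∑ (allFin (suc k)) (summand x)) units)
      ≡⟨ ∑-allVecs-∏ (allFin (suc k)) summand units ⟨
    ∑ (allVecs (allFin (suc k)) t) (λ ys → ∏ (zipWith summand units ys))
      ≡⟨ ∑-cong (allVecs (allFin (suc k)) t) (λ ys → trans (cong ∏ (drop ys)) (∏-* _ _ ys)) ⟩
    ∑ (allVecs (allFin (suc k)) t) (λ ys → monomial ys * gaussV m ys) ∎
    where
    -- A power is a product over `t` indices that carry no data.
    units : Vec ⊤ t
    units = replicate t tt
    summand : ⊤ → Fin (suc k) → ℤ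
    summand _ y = q ^ toℕ y * gauss m (toℕ y)
    drop : ∀ {s} (ys : Vec (Fin (suc k)) s) → zipWith summand (replicate s tt) ys ≡ Vec.map (summand tt) ys
    drop []       = refl
    drop (y ∷ ys) = cong (summand tt y ∷_) (drop ys)

  -- Splits by whether the position just before the last k + 1 entries is a common ascent.
  total-step : ∀ k m → total (suc k) * gauss (suc m) (suc k) ^ t ≡ mixed k (suc m) + mixed (suc k) m
  total-step k m = begin
    total (suc k) * gauss (suc m) (suc k) ^ t
      ≡⟨ cong (total (suc k) *_) (gauss-^ m (suc k)) ⟩
    total (suc k) * ∑ Ys g
      ≡⟨ ∑-*ʳ Xs (headed k) (∑ Ys g) ⟨
    ∑ Xs (λ xs → headed k xs * ∑ Ys g)
      ≡⟨ ∑-cong Xs (λ xs → sym (∑-*ˡ Ys (headed k xs) g)) ⟩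
    ∑ Xs (λ xs → ∑ Ys (λ ys → headed k xs * g ys))
      ≡⟨ ∑-cong Xs (λ xs → trans (∑-cong Ys (split xs)) (∑-+ Ys _ _)) ⟩
    ∑ Xs (λ xs → ∑ Ys (λ ys → headed k xs * (𝟙 (ys ≤ᵛ xs) * g ys))
      + ∑ Ys (λ ys → 𝟙 (not (ys ≤ᵛ xs)) * headed k xs * g ys))
      ≡⟨ ∑-+ Xs _ _ ⟩
    ∑ Xs (λ xs → ∑ Ys (λ ys → headed k xs * (𝟙 (ys ≤ᵛ xs) * g ys)))
      + ∑ Xs (λ xs → ∑ Ys (λ ys → 𝟙 (not (ys ≤ᵛ xs)) * headed k xs * g ys))
      -- At a common ascent `ys` joins the ascending part in front; otherwise it becomes the head of
      -- a longer part without common ascents.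
      ≡⟨ cong₂ _+_ (∑-cong Xs ascending) (trans (∑-swap Xs Ys _) (∑-cong Ys extend)) ⟩
    mixed k (suc m) + mixed (suc k) m ∎
    where
    Xs : List (Vec (Fin (suc k)) t)
    Xs = allVecs (allFin (suc k)) t
    Ys : List (Vec (Fin (suc (suc k))) t)
    Ys = allVecs (allFin (suc (suc k))) t
    g : Vec (Fin (suc (suc k))) t → ℤ
    g ys = monomial ys * gaussV m ys
    split : ∀ xs ys → headed k xs * g ys ≡
      headed k xs * (𝟙 (ys ≤ᵛ xs) * g ys) + 𝟙 (not (ys ≤ᵛ xs)) * headed k xs * g ys
    split xs ys with ys ≤ᵛ xs
    ... | true  = lemma (headed k xs) (g ys)
      where
      lemma : ∀ a b → a * b ≡ a * (1ℤ * b) + 0ℤ * a * b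
      lemma = solve-∀
    ... | false = lemma (headed k xs) (g ys)
      where
      lemma : ∀ a b → a * b ≡ a * (0ℤ * b) + 1ℤ * a * b
      lemma = solve-∀
    ascending : ∀ xs → ∑ Ys (λ ys → headed k xs * (𝟙 (ys ≤ᵛ xs) * g ys)) ≡ headed k xs * gaussV (suc m) xs
    ascending xs = trans (∑-*ˡ Ys (headed k xs) _) (cong (headed k xs *_) (sym (gaussV-suc m xs)))
    extend : ∀ ys → ∑ Xs (λ xs → 𝟙 (not (ys ≤ᵛ xs)) * headed k xs * g ys) ≡ headed (suc k) ys * gaussV m ys
    extend ys = trans (∑-*ʳ Xs _ (g ys)) (lemma (∑ Xs _) (monomial ys) (gaussV m ys))
      where
      lemma : ∀ s a b → s * (a * b) ≡ a * s * b
      lemma = solve-∀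

  -- Since `gauss m j` is the Gaussian binomial [m + j, j], this is the unsigned summand of the
  -- recurrence for `n = m + j`.
  term : ℕ → ℕ → ℤ
  term m j = total j * gauss m j ^ t

  -- By `total-step` neighbouring terms share one `mixed` summand, which cancels. The final term has
  -- nothing in front of its part without common ascents and is a single `mixed` value, so only the
  -- first half of the first term survives.
  alternating : ∀ m k → ∑ (upTo (suc m)) (λ i → -1ℤ ^ i * term (m ℕ.∸ i) (i ℕ.+ suc k)) ≡ mixed k m
  alternating zero k = begin
    ∑ (upTo 1) (λ i → -1ℤ ^ i * term (0 ℕ.∸ i) (i ℕ.+ suc k))
      ≡⟨ ∑-singleton 0 _ ⟩
    1ℤ * (total (suc k) * 1ℤ ^ t)
      ≡⟨ ℤₚ.*-identityˡ _ ⟩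
    total (suc k) * 1ℤ ^ t
      ≡⟨ ∑-*ʳ (allVecs (allFin (suc k)) t) (headed k) (1ℤ ^ t) ⟨
    ∑ (allVecs (allFin (suc k)) t) (λ xs → headed k xs * 1ℤ ^ t)
      ≡⟨ ∑-cong (allVecs (allFin (suc k)) t) (λ xs → cong (headed k xs *_) (sym (∏-const xs (λ _ → refl)))) ⟩
    mixed k 0 ∎
  alternating (suc m) k = begin
    ∑ (upTo (suc (suc m))) (λ i → -1ℤ ^ i * term (suc m ℕ.∸ i) (i ℕ.+ suc k))
      ≡⟨ ∑-upTo (suc m) _ ⟩
    1ℤ * term (suc m) (suc k) + ∑ (upTo (suc m)) (λ i → -1ℤ * -1ℤ ^ i * term (m ℕ.∸ i) (suc i ℕ.+ suc k))
      ≡⟨ cong₂ _+_ (trans (ℤₚ.*-identityˡ _) (total-step k m)) (trans (∑-cong (upTo (suc m)) shift) (∑-*ˡ (upTo (suc m)) -1ℤ _)) ⟩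
    mixed k (suc m) + mixed (suc k) m + -1ℤ * ∑ (upTo (suc m)) (λ i → -1ℤ ^ i * term (m ℕ.∸ i) (i ℕ.+ suc (suc k)))
      ≡⟨ cong (λ x → mixed k (suc m) + mixed (suc k) m + -1ℤ * x) (alternating m (suc k)) ⟩
    mixed k (suc m) + mixed (suc k) m + -1ℤ * mixed (suc k) m
      ≡⟨ lemma (mixed k (suc m)) (mixed (suc k) m) ⟩
    mixed k (suc m) ∎
    where
    lemma : ∀ a b → a + b + -1ℤ * b ≡ a
    lemma = solve-∀
    shift : ∀ i → -1ℤ * -1ℤ ^ i * term (m ℕ.∸ i) (suc i ℕ.+ suc k) ≡
      -1ℤ * (-1ℤ ^ i * term (m ℕ.∸ i) (i ℕ.+ suc (suc k)))
    shift i = trans (ℤₚ.*-assoc -1ℤ (-1ℤ ^ i) _)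
      (cong (λ j → -1ℤ * (-1ℤ ^ i * term (m ℕ.∸ i) j)) (sym (ℕₚ.+-suc i (suc k))))

  -- If the last part is a single entry, all positions are common ascents; only the tuple of
  -- identity permutations remains, and it has no inversions.
  mixed-zero : ∀ m → mixed 0 m ≡ 1ℤ
  mixed-zero m = begin
    ∑ (allVecs (zero ∷ []) t) (λ xs → 1ℤ * gaussV m xs)
      ≡⟨ ∑-allVecs-singleton zero t _ ⟩
    1ℤ * gaussV {1} m (replicate t zero)
      ≡⟨ ℤₚ.*-identityˡ _ ⟩
    gaussV {1} m (replicate t zero)
      ≡⟨ ∏-const (replicate t (zero {0})) (λ i → trans (cong (gauss m ∘ toℕ) (Vecₚ.lookup-replicate i zero)) (gauss-zero m)) ⟩
    1ℤ ^ t
      ≡⟨ ℤₚ.^-zeroˡ t ⟩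
    1ℤ ∎

  -- The term `j = 0` is the weight 1 of the tuple of identities, and the remaining terms telescope
  -- to the same weight with the opposite sign.
  total-recurrence : ∀ n → ∑ (upTo (suc (suc n))) (λ j → -1ℤ ^ j * term (suc n ℕ.∸ j) j) ≡ 0ℤ
  total-recurrence n = begin
    ∑ (upTo (suc (suc n))) (λ j → -1ℤ ^ j * term (suc n ℕ.∸ j) j)
      ≡⟨ ∑-upTo (suc n) _ ⟩
    1ℤ * (1ℤ * gauss (suc n) 0 ^ t) + ∑ (upTo (suc n)) (λ i → -1ℤ * -1ℤ ^ i * term (n ℕ.∸ i) (suc i))
      ≡⟨ cong₂ _+_ first (trans (∑-cong (upTo (suc n)) shift) (∑-*ˡ (upTo (suc n)) -1ℤ _)) ⟩
    1ℤ + -1ℤ * ∑ (upTo (suc n)) (λ i → -1ℤ ^ i * term (n ℕ.∸ i) (i ℕ.+ 1))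
      ≡⟨ cong (λ x → 1ℤ + -1ℤ * x) (trans (alternating n 0) (mixed-zero n)) ⟩
    0ℤ ∎
    where
    first : 1ℤ * (1ℤ * gauss (suc n) 0 ^ t) ≡ 1ℤ
    first = trans (ℤₚ.*-identityˡ _) (trans (ℤₚ.*-identityˡ _)
      (trans (cong (_^ t) (gauss-zero (suc n))) (ℤₚ.^-zeroˡ t)))
    shift : ∀ i → -1ℤ * -1ℤ ^ i * term (n ℕ.∸ i) (suc i) ≡ -1ℤ * (-1ℤ ^ i * term (n ℕ.∸ i) (i ℕ.+ 1))
    shift i = trans (ℤₚ.*-assoc -1ℤ (-1ℤ ^ i) _)
      (cong (λ j → -1ℤ * (-1ℤ ^ i * term (n ℕ.∸ i) j)) (ℕₚ.+-comm 1 i))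

-- Lehmer codes

-- The bounds on the entries are built into the type, so every inhabitant is the code of a
-- permutation.
data Code : ℕ → Set where
  []  : Code zero
  _∷_ : Fin (suc n) → Code n → Code (suc n)

codes : (n : ℕ) → List (Code n)
codes zero    = [] ∷ []
codes (suc n) = concatMap (λ y → map (y ∷_) (codes n)) (allFin (suc n))

-- The first value is the first entry `y` itself, as exactly the `y` smaller values come after it.
-- `punchIn y` moves the rest, in order, onto the values other than `y`.
decode : Code n → Vec (Fin n) n
decode []      = []
decode (y ∷ c) = y ∷ Vec.map (punchIn y) (decode c)

∑-codes : (n : ℕ) (f : Code (suc n) → ℤ) →
  ∑ (codes (suc n)) f ≡ ∑ (allFin (suc n)) (λ y → ∑ (codes n) (λ c → f (y ∷ c)))
∑-codes n f = trans (∑-concatMap (λ y → map (y ∷_) (codes n)) (allFin (suc n)) f)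
  (∑-cong (allFin (suc n)) (λ y → ∑-map (y ∷_) (codes n) f))

∑-punchIn : (y : Fin (suc n)) (f : Fin (suc n) → ℤ) →
  ∑ (allFin (suc n)) f ≡ f y + ∑ (allFin n) (f ∘ punchIn y)
∑-punchIn {n}     zero    f = ∑-allFin n f
∑-punchIn {suc n} (suc y) f = begin
  ∑ (allFin (suc (suc n))) f
    ≡⟨ ∑-allFin (suc n) f ⟩
  f zero + ∑ (allFin (suc n)) (f ∘ suc)
    ≡⟨ cong (_+_ (f zero)) (∑-punchIn y (f ∘ suc)) ⟩
  f zero + (f (suc y) + ∑ (allFin n) (f ∘ suc ∘ punchIn y))
    ≡⟨ lemma (f zero) (f (suc y)) _ ⟩
  f (suc y) + (f zero + ∑ (allFin n) (f ∘ suc ∘ punchIn y))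
    ≡⟨ cong (_+_ (f (suc y))) (∑-allFin n (f ∘ punchIn (suc y))) ⟨
  f (suc y) + ∑ (allFin (suc n)) (f ∘ punchIn (suc y)) ∎
  where
  lemma : ∀ a b c → a + (b + c) ≡ b + (a + c)
  lemma = solve-∀

-- Permutations as decoded codes

_≢ᵇ_ : Fin n → Fin n → Bool
i ≢ᵇ j = not ⌊ i ≟ᶠ j ⌋

≢ᵇ-elim : {i j : Fin n} → i ≢ᵇ j ≡ true → i ≢ j
≢ᵇ-elim {i = i} {j} e with i ≟ᶠ j
... | no i≢j = i≢j

≢ᵇ-intro : {i j : Fin n} → i ≢ j → i ≢ᵇ j ≡ true
≢ᵇ-intro {i = i} {j} i≢j with i ≟ᶠ j
... | yes i≡j = contradiction i≡j i≢j
... | no _    = refl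

≢ᵇ-punchIn : (y : Fin (suc n)) (a b : Fin n) → punchIn y a ≢ᵇ punchIn y b ≡ a ≢ᵇ b
≢ᵇ-punchIn y a b = bool-ext
  (λ e → ≢ᵇ-intro (≢ᵇ-elim e ∘ cong (punchIn y)))
  (λ e → ≢ᵇ-intro (≢ᵇ-elim e ∘ punchIn-injective y a b))

-- The words avoiding `y` are the words in one letter less, relabelled by `punchIn y`; letter by
-- letter, the indicator removes `y` and `∑-punchIn` lists the others.
∑-avoiding : (y : Fin (suc n)) (m : ℕ) (f : Vec (Fin (suc n)) m → ℤ) →
  ∑ (allVecs (allFin (suc n)) m) (λ v → 𝟙 (allV (y ≢ᵇ_) v) * f v) ≡
  ∑ (allVecs (allFin n) m) (f ∘ Vec.map (punchIn y))
∑-avoiding y zero f = trans (∑-singleton [] _) (trans (ℤₚ.*-identityˡ (f [])) (sym (∑-singleton [] _)))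
∑-avoiding {n} y (suc m) f = begin
  ∑ (allVecs (allFin (suc n)) (suc m)) (λ v → 𝟙 (allV (y ≢ᵇ_) v) * f v)
    ≡⟨ ∑-allVecs (allFin (suc n)) m _ ⟩
  ∑ (allFin (suc n)) (λ x → ∑ (allVecs (allFin (suc n)) m) (λ v → 𝟙 ((y ≢ᵇ x) ∧ allV (y ≢ᵇ_) v) * f (x ∷ v)))
    ≡⟨ ∑-cong (allFin (suc n)) inner ⟩
  ∑ (allFin (suc n)) (λ x → 𝟙 (y ≢ᵇ x) * g x)
    ≡⟨ ∑-punchIn y _ ⟩
  𝟙 (y ≢ᵇ y) * g y + ∑ (allFin n) (λ x → 𝟙 (y ≢ᵇ punchIn y x) * g (punchIn y x))
    ≡⟨ cong₂ _+_
         (cong (λ b → 𝟙 (not b) * g y) (trans (isYes≗does (y ≟ᶠ y)) (dec-true (y ≟ᶠ y) refl)))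
         (∑-cong (allFin n) (λ x → trans (cong (λ b → 𝟙 b * g (punchIn y x)) (≢ᵇ-intro (punchInᵢ≢i y x ∘ sym))) (ℤₚ.*-identityˡ _))) ⟩
  0ℤ + ∑ (allFin n) (g ∘ punchIn y)
    ≡⟨ ℤₚ.+-identityˡ _ ⟩
  ∑ (allFin n) (g ∘ punchIn y)
    ≡⟨ ∑-allVecs (allFin n) m _ ⟨
  ∑ (allVecs (allFin n) (suc m)) (f ∘ Vec.map (punchIn y)) ∎
  where
  g : Fin (suc n) → ℤ
  g x = ∑ (allVecs (allFin n) m) (λ u → f (x ∷ Vec.map (punchIn y) u))
  inner : ∀ x → ∑ (allVecs (allFin (suc n)) m) (λ v → 𝟙 ((y ≢ᵇ x) ∧ allV (y ≢ᵇ_) v) * f (x ∷ v)) ≡ 𝟙 (y ≢ᵇ x) * g x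
  inner x = begin
    ∑ (allVecs (allFin (suc n)) m) (λ v → 𝟙 ((y ≢ᵇ x) ∧ allV (y ≢ᵇ_) v) * f (x ∷ v))
      ≡⟨ ∑-cong (allVecs (allFin (suc n)) m) (λ v →
           trans (cong (_* f (x ∷ v)) (𝟙-∧ (y ≢ᵇ x) _)) (ℤₚ.*-assoc (𝟙 (y ≢ᵇ x)) _ _)) ⟩
    ∑ (allVecs (allFin (suc n)) m) (λ v → 𝟙 (y ≢ᵇ x) * (𝟙 (allV (y ≢ᵇ_) v) * f (x ∷ v)))
      ≡⟨ ∑-*ˡ (allVecs (allFin (suc n)) m) (𝟙 (y ≢ᵇ x)) _ ⟩
    𝟙 (y ≢ᵇ x) * ∑ (allVecs (allFin (suc n)) m) (λ v → 𝟙 (allV (y ≢ᵇ_) v) * f (x ∷ v))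
      ≡⟨ cong (𝟙 (y ≢ᵇ x) *_) (∑-avoiding y m (λ v → f (x ∷ v))) ⟩
    𝟙 (y ≢ᵇ x) * g x ∎

-- Injectivity in the recursive form that follows the recursion of `decode`.
distinct : Vec (Fin n) m → Bool
distinct []      = true
distinct (x ∷ v) = allV (x ≢ᵇ_) v ∧ distinct v

distinct-punchIn : (y : Fin (suc n)) (v : Vec (Fin n) m) → distinct (Vec.map (punchIn y) v) ≡ distinct v
distinct-punchIn y []      = refl
distinct-punchIn y (x ∷ v) = cong₂ _∧_ (avoid v) (distinct-punchIn y v)
  where
  avoid : ∀ {k} (u : Vec _ k) → allV (punchIn y x ≢ᵇ_) (Vec.map (punchIn y) u) ≡ allV (x ≢ᵇ_) u
  avoid []      = refl
  avoid (z ∷ u) = cong₂ _∧_ (≢ᵇ-punchIn y x z) (avoid u)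

distinct-elim : (v : Vec (Fin n) m) → distinct v ≡ true → ∀ {i j} → i ≢ j → lookup v i ≢ lookup v j
distinct-elim (x ∷ v) e {zero}  {zero}  i≢j _ = i≢j refl
distinct-elim (x ∷ v) e {zero}  {suc j} i≢j p = ≢ᵇ-elim (allV-elim v (proj₁ (∧-true e)) j) p
distinct-elim (x ∷ v) e {suc i} {zero}  i≢j p = ≢ᵇ-elim (allV-elim v (proj₁ (∧-true e)) i) (sym p)
distinct-elim (x ∷ v) e {suc i} {suc j} i≢j p = distinct-elim v (proj₂ (∧-true e)) (i≢j ∘ cong suc) p

distinct-intro : (v : Vec (Fin n) m) → (∀ {i j} → i ≢ j → lookup v i ≢ lookup v j) → distinct v ≡ true
distinct-intro []      f = refl
distinct-intro (x ∷ v) f = ∧-intro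
  (allV-intro v (λ i → ≢ᵇ-intro (f {zero} {suc i} (λ ()))))
  (distinct-intro v (λ i≢j → f (i≢j ∘ Finₚ.suc-injective)))

injectiveᵇ-distinct : (σ : Vec (Fin n) n) → injectiveᵇ σ ≡ distinct σ
injectiveᵇ-distinct σ = bool-ext
  (λ e → distinct-intro σ (λ {i} {j} i≢j → ≢ᵇ-elim (separated i≢j (allL-elim (allL-elim e (∈-allFin i)) (∈-allFin j)))))
  (λ e → allL-intro (allFin _) (λ i → allL-intro (allFin _) (λ j → separate {i} {j} (distinct-elim σ e))))
  where
  separated : ∀ {i j} {b : Bool} → i ≢ j → ⌊ i ≟ᶠ j ⌋ ∨ b ≡ true → b ≡ true
  separated {i} {j} i≢j e with i ≟ᶠ j
  ... | yes i≡j = contradiction i≡j i≢j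
  ... | no _    = e
  separate : ∀ {i j} → (i ≢ j → lookup σ i ≢ lookup σ j) → ⌊ i ≟ᶠ j ⌋ ∨ (lookup σ i ≢ᵇ lookup σ j) ≡ true
  separate {i} {j} f with i ≟ᶠ j
  ... | yes _  = refl
  ... | no i≢j = ≢ᵇ-intro (f i≢j)

-- Bijectivity of `decode`: an injective word is a first letter followed by an injective word in the
-- remaining letters.
∑-distinct : (n : ℕ) (f : Vec (Fin n) n → ℤ) →
  ∑ (allVecs (allFin n) n) (λ σ → 𝟙 (distinct σ) * f σ) ≡ ∑ (codes n) (f ∘ decode)
∑-distinct zero f = trans (∑-singleton [] _) (trans (ℤₚ.*-identityˡ _) (sym (∑-singleton [] _)))
∑-distinct (suc n) f = begin
  ∑ (allVecs (allFin (suc n)) (suc n)) (λ σ → 𝟙 (distinct σ) * f σ)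
    ≡⟨ ∑-allVecs (allFin (suc n)) n _ ⟩
  ∑ (allFin (suc n)) (λ y → ∑ (allVecs (allFin (suc n)) n) (λ v → 𝟙 (allV (y ≢ᵇ_) v ∧ distinct v) * f (y ∷ v)))
    ≡⟨ ∑-cong (allFin (suc n)) inner ⟩
  ∑ (allFin (suc n)) (λ y → ∑ (codes n) (λ c → f (decode (y ∷ c))))
    ≡⟨ ∑-codes n _ ⟨
  ∑ (codes (suc n)) (f ∘ decode) ∎
  where
  inner : ∀ y → ∑ (allVecs (allFin (suc n)) n) (λ v → 𝟙 (allV (y ≢ᵇ_) v ∧ distinct v) * f (y ∷ v)) ≡
    ∑ (codes n) (λ c → f (decode (y ∷ c)))
  inner y = begin
    ∑ (allVecs (allFin (suc n)) n) (λ v → 𝟙 (allV (y ≢ᵇ_) v ∧ distinct v) * f (y ∷ v))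
      ≡⟨ ∑-cong (allVecs (allFin (suc n)) n) (λ v →
           trans (cong (_* f (y ∷ v)) (𝟙-∧ (allV (y ≢ᵇ_) v) _)) (ℤₚ.*-assoc (𝟙 (allV (y ≢ᵇ_) v)) _ _)) ⟩
    ∑ (allVecs (allFin (suc n)) n) (λ v → 𝟙 (allV (y ≢ᵇ_) v) * (𝟙 (distinct v) * f (y ∷ v)))
      ≡⟨ ∑-avoiding y n _ ⟩
    ∑ (allVecs (allFin n) n) (λ u → 𝟙 (distinct (Vec.map (punchIn y) u)) * f (y ∷ Vec.map (punchIn y) u))
      ≡⟨ ∑-cong (allVecs (allFin n) n) (λ u → cong (λ b → 𝟙 b * f (y ∷ Vec.map (punchIn y) u)) (distinct-punchIn y u)) ⟩
    ∑ (allVecs (allFin n) n) (λ u → 𝟙 (distinct u) * f (y ∷ Vec.map (punchIn y) u))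
      ≡⟨ ∑-distinct n (λ u → f (y ∷ Vec.map (punchIn y) u)) ⟩
    ∑ (codes n) (λ c → f (decode (y ∷ c))) ∎

∑-perms : (n : ℕ) (f : Vec (Fin n) n → ℤ) → ∑ (perms n) f ≡ ∑ (codes n) (f ∘ decode)
∑-perms n f = begin
  ∑ (perms n) f
    ≡⟨ ∑-filter-true injectiveᵇ (allVecs (allFin n) n) f ⟩
  ∑ (allVecs (allFin n) n) (λ σ → 𝟙 (injectiveᵇ σ) * f σ)
    ≡⟨ ∑-cong (allVecs (allFin n) n) (λ σ → cong (λ b → 𝟙 b * f σ) (injectiveᵇ-distinct σ)) ⟩
  ∑ (allVecs (allFin n) n) (λ σ → 𝟙 (distinct σ) * f σ)
    ≡⟨ ∑-distinct n f ⟩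
  ∑ (codes n) (f ∘ decode) ∎

-- Each value occurs once in a decoded word, so summing over positions is summing over values.
∑-decode : (c : Code n) (f : Fin n → ℤ) → ∑ (allFin n) (f ∘ lookup (decode c)) ≡ ∑ (allFin n) f
∑-decode []      f = trans (∑-[] _) (sym (∑-[] f))
∑-decode {suc n} (y ∷ c) f = begin
  ∑ (allFin (suc n)) (f ∘ lookup (decode (y ∷ c)))
    ≡⟨ ∑-allFin n _ ⟩
  f y + ∑ (allFin n) (λ i → f (lookup (Vec.map (punchIn y) (decode c)) i))
    ≡⟨ cong (_+_ (f y)) (∑-cong (allFin n) (λ i → cong f (Vecₚ.lookup-map i (punchIn y) (decode c)))) ⟩
  f y + ∑ (allFin n) (f ∘ punchIn y ∘ lookup (decode c))
    ≡⟨ cong (_+_ (f y)) (∑-decode c (f ∘ punchIn y)) ⟩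
  f y + ∑ (allFin n) (f ∘ punchIn y)
    ≡⟨ ∑-punchIn y f ⟨
  ∑ (allFin (suc n)) f ∎

-- Inversions of a decoded code

_<′_ : Fin m → Fin n → Bool
i <′ j = toℕ i ℕ.<ᵇ toℕ j

-- Passes to `_<ᵇ_`, which computes on constructors; comparisons with `punchIn` then go by recursion
-- on both arguments.
<ᶠ-<′ : (i j : Fin n) → (i <ᶠ j) ≡ (i <′ j)
<ᶠ-<′ i j = isYes≗does (toℕ i ℕ.<? toℕ j)

<′-punchIn : (y : Fin (suc n)) (a b : Fin n) → (punchIn y a <′ punchIn y b) ≡ (a <′ b)
<′-punchIn zero    a       b       = refl
<′-punchIn (suc y) zero    zero    = refl
<′-punchIn (suc y) zero    (suc b) = refl
<′-punchIn (suc y) (suc a) zero    = refl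
<′-punchIn (suc y) (suc a) (suc b) = <′-punchIn y a b

punchIn-<′ : (y : Fin (suc n)) (a : Fin n) → (punchIn y a <′ y) ≡ (a <′ y)
punchIn-<′ zero    a       = refl
punchIn-<′ (suc y) zero    = refl
punchIn-<′ (suc y) (suc a) = punchIn-<′ y a

-- Origin of the weak inequality in the ascent criterion: relabelling moves `a` past `y` exactly
-- when `y ≤ a`.
<′-punchIn-self : (y : Fin (suc n)) (a : Fin n) → (y <′ punchIn y a) ≡ (toℕ y ℕ.<ᵇ suc (toℕ a))
<′-punchIn-self zero    a       = refl
<′-punchIn-self (suc y) zero    = refl
<′-punchIn-self (suc y) (suc a) = <′-punchIn-self y a

∑-below : (y : Fin (suc n)) → ∑ (allFin n) (λ x → 𝟙 (x <′ y)) ≡ + toℕ y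
∑-below {n}     zero    = ∑-zero (allFin n)
∑-below {suc n} (suc y) = trans (∑-allFin n _) (cong (_+_ 1ℤ) (∑-below y))

inversion : Vec (Fin n) n → Fin n → Fin n → ℤ
inversion σ i j = 𝟙 ((i <′ j) ∧ (lookup σ j <′ lookup σ i))

inv-∑ : (σ : Vec (Fin n) n) → + inv σ ≡ ∑ (allFin n) (λ i → ∑ (allFin n) (inversion σ i))
inv-∑ {n} σ = trans (sumℕ-∑ (allFin n) _) (∑-cong (allFin n) (λ i → trans (countL-∑ _ (allFin n))
  (∑-cong (allFin n) (λ j → cong 𝟙 (cong₂ _∧_ (<ᶠ-<′ i j) (<ᶠ-<′ (lookup σ j) (lookup σ i)))))))

-- The first position is inverted with the positions of the `y` smaller values, all of which come
-- later. The other inversions are those of `decode c`, because `punchIn y` preserves order.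
inv-decode : (y : Fin (suc n)) (c : Code n) → inv (decode (y ∷ c)) ≡ toℕ y ℕ.+ inv (decode c)
inv-decode {n} y c = ℤₚ.+-injective (begin
  + inv σ
    ≡⟨ inv-∑ σ ⟩
  ∑ (allFin (suc n)) (λ i → ∑ (allFin (suc n)) (inversion σ i))
    ≡⟨ ∑-allFin n _ ⟩
  ∑ (allFin (suc n)) (inversion σ zero) + ∑ (allFin n) (λ i → ∑ (allFin (suc n)) (inversion σ (suc i)))
    ≡⟨ cong₂ _+_ first (∑-cong (allFin n) later) ⟩
  + toℕ y + ∑ (allFin n) (λ i → ∑ (allFin n) (inversion (decode c) i))
    ≡⟨ cong (_+_ (+ toℕ y)) (inv-∑ (decode c)) ⟨
  + toℕ y + + inv (decode c)
    ≡⟨ ℤₚ.pos-+ (toℕ y) _ ⟨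
  + (toℕ y ℕ.+ inv (decode c)) ∎)
  where
  σ : Vec (Fin (suc n)) (suc n)
  σ = decode (y ∷ c)
  entry : ∀ i → lookup σ (suc i) ≡ punchIn y (lookup (decode c) i)
  entry i = Vecₚ.lookup-map i (punchIn y) (decode c)
  first : ∑ (allFin (suc n)) (inversion σ zero) ≡ + toℕ y
  first = begin
    ∑ (allFin (suc n)) (inversion σ zero)
      ≡⟨ trans (∑-allFin n _) (ℤₚ.+-identityˡ _) ⟩
    ∑ (allFin n) (λ j → 𝟙 (lookup σ (suc j) <′ y))
      ≡⟨ ∑-cong (allFin n) (λ j → cong 𝟙 (trans (cong (_<′ y) (entry j)) (punchIn-<′ y _))) ⟩
    ∑ (allFin n) (λ j → 𝟙 (lookup (decode c) j <′ y))
      ≡⟨ ∑-decode c _ ⟩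
    ∑ (allFin n) (λ x → 𝟙 (x <′ y))
      ≡⟨ ∑-below y ⟩
    + toℕ y ∎
  later : ∀ i → ∑ (allFin (suc n)) (inversion σ (suc i)) ≡ ∑ (allFin n) (inversion (decode c) i)
  later i = trans (∑-allFin n _) (trans (ℤₚ.+-identityˡ _) (∑-cong (allFin n) (λ j →
    cong (λ b → 𝟙 ((i <′ j) ∧ b)) (trans (cong₂ _<′_ (entry j) (entry i)) (<′-punchIn y _ _)))))

-- A tuple of pairs is a pair of tuples. Applied to `_∷_`, it separates the first entries of a tuple
-- of codes from their tails.
∑-allVecs-pair : {xs : List A} {ys : List C} {zs : List D} (_∙_ : A → C → D) →
  (∀ f → ∑ zs f ≡ ∑ xs (λ x → ∑ ys (λ y → f (x ∙ y)))) → ∀ t f →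
  ∑ (allVecs zs t) f ≡ ∑ (allVecs xs t) (λ us → ∑ (allVecs ys t) (λ vs → f (zipWith _∙_ us vs)))
∑-allVecs-pair _∙_ e zero f = trans (∑-singleton [] f)
  (sym (trans (∑-singleton [] _) (∑-singleton [] _)))
∑-allVecs-pair {xs = xs} {ys} {zs} _∙_ e (suc t) f = begin
  ∑ (allVecs zs (suc t)) f
    ≡⟨ ∑-allVecs zs t f ⟩
  ∑ zs (λ z → ∑ (allVecs zs t) (λ ws → f (z ∷ ws)))
    ≡⟨ e _ ⟩
  ∑ xs (λ x → ∑ ys (λ y → ∑ (allVecs zs t) (λ ws → f ((x ∙ y) ∷ ws))))
    ≡⟨ ∑-cong xs (λ x → ∑-cong ys (λ y → ∑-allVecs-pair _∙_ e t _)) ⟩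
  ∑ xs (λ x → ∑ ys (λ y → ∑ (allVecs xs t) (λ us → ∑ (allVecs ys t) (λ vs → f ((x ∙ y) ∷ zipWith _∙_ us vs)))))
    ≡⟨ ∑-cong xs (λ x → ∑-swap ys (allVecs xs t) _) ⟩
  ∑ xs (λ x → ∑ (allVecs xs t) (λ us → ∑ ys (λ y → ∑ (allVecs ys t) (λ vs → f ((x ∙ y) ∷ zipWith _∙_ us vs)))))
    ≡⟨ ∑-cong xs (λ x → ∑-cong (allVecs xs t) (λ us → sym (∑-allVecs ys t _))) ⟩
  ∑ xs (λ x → ∑ (allVecs xs t) (λ us → ∑ (allVecs ys (suc t)) (λ vs → f (zipWith _∙_ (x ∷ us) vs))))
    ≡⟨ ∑-allVecs xs t _ ⟨
  ∑ (allVecs xs (suc t)) (λ us → ∑ (allVecs ys (suc t)) (λ vs → f (zipWith _∙_ us vs))) ∎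

-- Common ascents of tuples of codes

anyL-cong : {p r : A → Bool} (xs : List A) → (∀ x → p x ≡ r x) → anyL p xs ≡ anyL r xs
anyL-cong []       e = refl
anyL-cong (x ∷ xs) e = cong₂ _∨_ (e x) (anyL-cong xs e)

anyL-false : (xs : List A) → anyL (λ _ → false) xs ≡ false
anyL-false []       = refl
anyL-false (x ∷ xs) = anyL-false xs

anyL-map : (p : A → Bool) (g : C → A) (xs : List C) → anyL p (map g xs) ≡ anyL (p ∘ g) xs
anyL-map p g []       = refl
anyL-map p g (x ∷ xs) = cong (p (g x) ∨_) (anyL-map p g xs)

anyL-allFin : (n : ℕ) (p : Fin (suc n) → Bool) →
  anyL p (allFin (suc n)) ≡ p zero ∨ anyL (p ∘ suc) (allFin n)
anyL-allFin n p = cong (p zero ∨_)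
  (trans (cong (anyL p) (sym (map-tabulate id suc))) (anyL-map p suc (allFin n)))

allV-cong : {p r : A → Bool} (v : Vec A n) → (∀ x → p x ≡ r x) → allV p v ≡ allV r v
allV-cong []      e = refl
allV-cong (x ∷ v) e = cong₂ _∧_ (e x) (allV-cong v e)

commonAscentAt : Vec (Vec (Fin n) n) t → Fin n → Fin n → Bool
commonAscentAt σs i j = (toℕ j ℕ.≡ᵇ suc (toℕ i)) ∧ allV (λ σ → lookup σ i <′ lookup σ j) σs

hasCommonAscent-≡ : (σs : Vec (Vec (Fin n) n) t) →
  hasCommonAscent σs ≡ anyL (λ i → anyL (commonAscentAt σs i) (allFin n)) (allFin n)
hasCommonAscent-≡ {n} σs = anyL-cong (allFin n) (λ i → anyL-cong (allFin n) (λ j →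
  trans (cong (consecutive i j ∧_) (allV-cong σs (λ σ →
    cong₂ _∧_ (isYes≗does (toℕ j ℕ.≟ suc (toℕ i))) (<ᶠ-<′ (lookup σ i) (lookup σ j)))))
  (trans (cong (_∧ allV (λ σ → (toℕ j ℕ.≡ᵇ suc (toℕ i)) ∧ (lookup σ i <′ lookup σ j)) σs) (isYes≗does (toℕ j ℕ.≟ suc (toℕ i)))) (absorb (toℕ j ℕ.≡ᵇ suc (toℕ i)) σs))))
  where
  absorb : {p : A → Bool} (b : Bool) (v : Vec A m) → b ∧ allV (λ x → b ∧ p x) v ≡ b ∧ allV p v
  absorb true  v = refl
  absorb false v = refl

decodeAll : Vec (Code n) t → Vec (Vec (Fin n) n) t
decodeAll = Vec.map decode

-- The first two values of each permutation are `y` and `punchIn y x`, which ascend iff `y ≤ x`. All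
-- later positions are unaffected, as `punchIn y` preserves order.
hasCommonAscent-∷ : (ys : Vec (Fin (suc (suc n))) t) (xs : Vec (Fin (suc n)) t) (cs : Vec (Code n) t) →
  hasCommonAscent (decodeAll (zipWith _∷_ ys (zipWith _∷_ xs cs))) ≡
  (ys ≤ᵛ xs) ∨ hasCommonAscent (decodeAll (zipWith _∷_ xs cs))
hasCommonAscent-∷ {n} {t} ys xs cs = begin
  hasCommonAscent σs
    ≡⟨ hasCommonAscent-≡ σs ⟩
  anyL (λ i → anyL (commonAscentAt σs i) (allFin (suc (suc n)))) (allFin (suc (suc n)))
    ≡⟨ anyL-allFin (suc n) (λ i → anyL (commonAscentAt σs i) (allFin (suc (suc n)))) ⟩
  anyL (commonAscentAt σs zero) (allFin (suc (suc n))) ∨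
  anyL (λ i → anyL (commonAscentAt σs (suc i)) (allFin (suc (suc n)))) (allFin (suc n))
    ≡⟨ cong₂ _∨_ first (anyL-cong (allFin (suc n)) (λ i →
         trans (anyL-allFin (suc n) (commonAscentAt σs (suc i))) (anyL-cong (allFin (suc n)) (later i)))) ⟩
  (ys ≤ᵛ xs) ∨ anyL (λ i → anyL (commonAscentAt τs i) (allFin (suc n))) (allFin (suc n))
    ≡⟨ cong ((ys ≤ᵛ xs) ∨_) (hasCommonAscent-≡ τs) ⟨
  (ys ≤ᵛ xs) ∨ hasCommonAscent τs ∎
  where
  σs : Vec (Vec (Fin (suc (suc n))) (suc (suc n))) t
  σs = decodeAll (zipWith _∷_ ys (zipWith _∷_ xs cs))
  τs : Vec (Vec (Fin (suc n)) (suc n)) t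
  τs = decodeAll (zipWith _∷_ xs cs)
  start : ∀ {s} (ys : Vec (Fin (suc (suc n))) s) (xs : Vec (Fin (suc n)) s) (cs : Vec (Code n) s) →
    allV (λ σ → lookup σ zero <′ lookup σ (suc zero)) (decodeAll (zipWith _∷_ ys (zipWith _∷_ xs cs))) ≡ (ys ≤ᵛ xs)
  start []       []       []       = refl
  start (y ∷ ys) (x ∷ xs) (c ∷ cs) = cong₂ _∧_ (<′-punchIn-self y x) (start ys xs cs)
  -- From position 0 only position 1 is consecutive: `j = 0` computes away, and so do all `j` from 2
  -- on.
  first : anyL (commonAscentAt σs zero) (allFin (suc (suc n))) ≡ (ys ≤ᵛ xs)
  first = trans (anyL-allFin (suc n) (commonAscentAt σs zero))
    (trans (anyL-allFin n (commonAscentAt σs zero ∘ suc))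
    (trans (cong₂ _∨_ (start ys xs cs) (anyL-false (allFin n))) (Boolₚ.∨-identityʳ _)))
  ascents : ∀ {s} i j (ys : Vec (Fin (suc (suc n))) s) (ds : Vec (Code (suc n)) s) →
    allV (λ σ → lookup σ (suc i) <′ lookup σ (suc j)) (decodeAll (zipWith _∷_ ys ds)) ≡
    allV (λ σ → lookup σ i <′ lookup σ j) (decodeAll ds)
  ascents i j []       []       = refl
  ascents i j (y ∷ ys) (d ∷ ds) = cong₂ _∧_
    (trans
      (cong₂ _<′_ (Vecₚ.lookup-map i (punchIn y) (decode d)) (Vecₚ.lookup-map j (punchIn y) (decode d)))
      (<′-punchIn y _ _))
    (ascents i j ys ds)
  later : ∀ i j → commonAscentAt σs (suc i) (suc j) ≡ commonAscentAt τs i j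
  later i j = cong ((toℕ j ℕ.≡ᵇ suc (toℕ i)) ∧_) (ascents i j ys (zipWith _∷_ xs cs))

-- `W` as a sum over tuples of codes

module Permutations (q t : ℕ) where
  open CodeSums (+ q) t

  Q : ℤ
  Q = + q

  weight : ∀ {s} → Vec (Code n) s → ℤ
  weight cs = ∏ (Vec.map (λ c → Q ^ inv (decode c)) cs)

  summand : Vec (Code n) t → ℤ
  summand cs = 𝟙 (not (hasCommonAscent (decodeAll cs))) * weight cs

  weight-∷ : ∀ {s} (ys : Vec (Fin (suc n)) s) (cs : Vec (Code n) s) →
    weight (zipWith _∷_ ys cs) ≡ ∏ (Vec.map (λ y → Q ^ toℕ y) ys) * weight cs
  weight-∷ []       []       = refl
  weight-∷ (y ∷ ys) (c ∷ cs) = trans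
    (cong₂ _*_ (trans (cong (Q ^_) (inv-decode y c)) (ℤₚ.^-distribˡ-+-* Q (toℕ y) _)) (weight-∷ ys cs))
    (interchange ℤₚ.*-commutativeSemigroup (Q ^ toℕ y) _ _ _)

  -- Fixing the next entries `xs` as well decides the first position, so the indicator factors by
  -- `hasCommonAscent-∷` and the weight by `inv-decode`; what remains is the recursion of `headed`.
  ∑-headed : ∀ k (ys : Vec (Fin (suc k)) t) →
    ∑ (allVecs (codes k) t) (λ cs → summand (zipWith _∷_ ys cs)) ≡ headed k ys
  ∑-headed zero ys = begin
    ∑ (allVecs ([] ∷ []) t) (λ cs → summand (zipWith _∷_ ys cs))
      ≡⟨ ∑-allVecs-singleton [] t _ ⟩
    -- Words of length 1 have no consecutive positions, so the indicator computes to 1.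
    1ℤ * weight (zipWith _∷_ ys (replicate t []))
      ≡⟨ trans (ℤₚ.*-identityˡ _) (weight-∷ ys (replicate t [])) ⟩
    monomial ys * weight (replicate t [])
      ≡⟨ cong₂ _*_ (∏-const ys only) (∏-const (replicate t []) (λ i → cong (λ c → Q ^ inv (decode c)) (Vecₚ.lookup-replicate i []))) ⟩
    1ℤ ^ t * 1ℤ ^ t
      ≡⟨ cong₂ _*_ (ℤₚ.^-zeroˡ t) (ℤₚ.^-zeroˡ t) ⟩
    1ℤ ∎
    where
    only : ∀ i → Q ^ toℕ (lookup ys i) ≡ 1ℤ
    only i with lookup ys i
    ... | zero = refl
  ∑-headed (suc k) ys = begin
    ∑ (allVecs (codes (suc k)) t) (λ cs → summand (zipWith _∷_ ys cs))
      ≡⟨ ∑-allVecs-pair _∷_ (∑-codes k) t _ ⟩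
    ∑ Xs (λ xs → ∑ Cs (λ cs → summand (zipWith _∷_ ys (zipWith _∷_ xs cs))))
      ≡⟨ ∑-cong Xs (λ xs → trans (∑-cong Cs (split xs)) (trans (∑-*ˡ Cs (monomial ys) _) (cong (monomial ys *_) (∑-*ˡ Cs (𝟙 (not (ys ≤ᵛ xs))) _)))) ⟩
    ∑ Xs (λ xs → monomial ys * (𝟙 (not (ys ≤ᵛ xs)) * ∑ Cs (λ cs → summand (zipWith _∷_ xs cs))))
      ≡⟨ ∑-*ˡ Xs (monomial ys) _ ⟩
    monomial ys * ∑ Xs (λ xs → 𝟙 (not (ys ≤ᵛ xs)) * ∑ Cs (λ cs → summand (zipWith _∷_ xs cs)))
      ≡⟨ cong (monomial ys *_) (∑-cong Xs (λ xs → cong (𝟙 (not (ys ≤ᵛ xs)) *_) (∑-headed k xs))) ⟩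
    headed (suc k) ys ∎
    where
    Xs : List (Vec (Fin (suc k)) t)
    Xs = allVecs (allFin (suc k)) t
    Cs : List (Vec (Code k) t)
    Cs = allVecs (codes k) t
    𝟙-not-∨ : ∀ a b → 𝟙 (not (a ∨ b)) ≡ 𝟙 (not a) * 𝟙 (not b)
    𝟙-not-∨ true  b = refl
    𝟙-not-∨ false b = sym (ℤₚ.*-identityˡ (𝟙 (not b)))
    split : ∀ xs cs → summand (zipWith _∷_ ys (zipWith _∷_ xs cs)) ≡
      monomial ys * (𝟙 (not (ys ≤ᵛ xs)) * summand (zipWith _∷_ xs cs))
    split xs cs = trans
      (cong₂ _*_ (trans (cong (𝟙 ∘ not) (hasCommonAscent-∷ ys xs cs)) (𝟙-not-∨ (ys ≤ᵛ xs) _)) (weight-∷ ys (zipWith _∷_ xs cs)))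
      (lemma (𝟙 (not (ys ≤ᵛ xs))) _ (monomial ys) _)
      where
      lemma : ∀ a b c d → a * b * (c * d) ≡ c * (a * (b * d))
      lemma = solve-∀

  W-codes : ∀ n → + W n t q ≡ ∑ (allVecs (codes n) t) summand
  W-codes n = begin
    + W n t q
      ≡⟨ sumℕ-∑ (filter (λ σs → hasCommonAscent σs Bool.≟ false) (allVecs (perms n) t)) _ ⟩
    ∑ (filter (λ σs → hasCommonAscent σs Bool.≟ false) (allVecs (perms n) t)) (λ σs → + prodVℕ (Vec.map (λ σ → q ℕ.^ inv σ) σs))
      ≡⟨ ∑-filter hasCommonAscent false (allVecs (perms n) t) _ ⟩
    ∑ (allVecs (perms n) t) (λ σs → 𝟙 ⌊ hasCommonAscent σs Bool.≟ false ⌋ * + prodVℕ (Vec.map (λ σ → q ℕ.^ inv σ) σs))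
      ≡⟨ ∑-allVecs-transport decode (∑-perms n) t _ ⟩
    ∑ (allVecs (codes n) t) (λ cs → 𝟙 ⌊ hasCommonAscent (decodeAll cs) Bool.≟ false ⌋ * + prodVℕ (Vec.map (λ σ → q ℕ.^ inv σ) (decodeAll cs)))
      ≡⟨ ∑-cong (allVecs (codes n) t) (λ cs → cong₂ _*_ (cong 𝟙 (≟-false (hasCommonAscent (decodeAll cs)))) (cast cs)) ⟩
    ∑ (allVecs (codes n) t) summand ∎
    where
    cast : ∀ {s} (cs : Vec (Code n) s) → + prodVℕ (Vec.map (λ σ → q ℕ.^ inv σ) (decodeAll cs)) ≡ weight cs
    cast []       = refl
    cast (c ∷ cs) = trans (ℤₚ.pos-* (q ℕ.^ inv (decode c)) _) (cong₂ _*_ (pos-^ q (inv (decode c))) (cast cs))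

  W-total : ∀ n → + W (suc n) t q ≡ total (suc n)
  W-total n = begin
    + W (suc n) t q
      ≡⟨ W-codes (suc n) ⟩
    ∑ (allVecs (codes (suc n)) t) summand
      ≡⟨ ∑-allVecs-pair _∷_ (∑-codes n) t summand ⟩
    ∑ (allVecs (allFin (suc n)) t) (λ ys → ∑ (allVecs (codes n) t) (λ cs → summand (zipWith _∷_ ys cs)))
      ≡⟨ ∑-cong (allVecs (allFin (suc n)) t) (∑-headed n) ⟩
    total (suc n) ∎

-- Indicator sums and vectors of tests

∑-- : (xs : List A) (f g : A → ℤ) → ∑ xs (λ x → f x - g x) ≡ ∑ xs f - ∑ xs g
∑-- xs f g = begin
  ∑ xs (λ x → f x - g x)
    ≡⟨ ∑-cong xs (λ x → cong (_+_ (f x)) (sym (ℤₚ.-1*i≡-i (g x)))) ⟩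
  ∑ xs (λ x → f x + -1ℤ * g x)
    ≡⟨ ∑-+ xs f _ ⟩
  ∑ xs f + ∑ xs (λ x → -1ℤ * g x)
    ≡⟨ cong (_+_ (∑ xs f)) (trans (∑-*ˡ xs -1ℤ g) (ℤₚ.-1*i≡-i (∑ xs g))) ⟩
  ∑ xs f - ∑ xs g ∎

∑-𝟙-zero : (p : A → Bool) (xs : List A) → ∑ xs (𝟙 ∘ p) ≡ 0ℤ → ∀ {x} → x ∈ xs → p x ≡ false
∑-𝟙-zero p (y ∷ xs) e x∈ with p y in eq | trans (sym (∑-∷ y xs (𝟙 ∘ p))) e
-- Written as `countL`, the rest of the sum is a natural number, and 1 plus a natural number is not
-- 0.
∑-𝟙-zero p (y ∷ xs) e x∈ | true | e′
  with () ← trans (cong (_+_ 1ℤ) (countL-∑ p xs)) e′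
∑-𝟙-zero p (y ∷ xs) e (here refl) | false | e′ = eq
∑-𝟙-zero p (y ∷ xs) e (there x∈)  | false | e′ = ∑-𝟙-zero p xs (trans (sym (ℤₚ.+-identityˡ _)) e′) x∈

∑-𝟙-≟ : (a : Fin n) → ∑ (allFin n) (λ b → 𝟙 ⌊ a ≟ᶠ b ⌋) ≡ 1ℤ
∑-𝟙-≟ {suc n} a = begin
  ∑ (allFin (suc n)) (λ b → 𝟙 ⌊ a ≟ᶠ b ⌋)
    ≡⟨ ∑-punchIn a _ ⟩
  𝟙 ⌊ a ≟ᶠ a ⌋ + ∑ (allFin n) (λ b → 𝟙 ⌊ a ≟ᶠ punchIn a b ⌋)
    ≡⟨ cong₂ _+_ (cong 𝟙 (trans (isYes≗does (a ≟ᶠ a)) (dec-true (a ≟ᶠ a) refl)))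
         (trans (∑-cong (allFin n) different) (∑-zero (allFin n))) ⟩
  1ℤ ∎
  where
  different : ∀ b → 𝟙 ⌊ a ≟ᶠ punchIn a b ⌋ ≡ 0ℤ
  different b with a ≟ᶠ punchIn a b
  ... | yes p = contradiction (sym p) (punchInᵢ≢i a b)
  ... | no _  = refl

-- Brings the coordinatewise tests of `agree` into the shape that `∑-allVecs-∏` expands.
tabulate-zipWith : {B : Set} (g : Fin n → A → B) (v : Vec A n) →
  Vec.tabulate (λ i → g i (lookup v i)) ≡ zipWith g (Vec.allFin n) v
tabulate-zipWith {n = n} g v = trans
  (Vecₚ.tabulate-cong (λ i → sym (trans (Vecₚ.lookup-zipWith g i (Vec.allFin n) v) (cong (λ k → g k (lookup v i)) (Vecₚ.lookup-allFin i)))))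
  (Vecₚ.tabulate∘lookup (zipWith g (Vec.allFin n) v))

_==ᵇ_ : Bool → Bool → Bool
true  ==ᵇ b = b
false ==ᵇ b = not b

==ᵇ-elim : ∀ {a b} → a ==ᵇ b ≡ true → a ≡ b
==ᵇ-elim {true}  {true}  _ = refl
==ᵇ-elim {false} {false} _ = refl

==ᵇ-intro : ∀ {a b} → a ≡ b → a ==ᵇ b ≡ true
==ᵇ-intro {true}  refl = refl
==ᵇ-intro {false} refl = refl

-- Linear algebra over a finite field

module Counting {q : ℕ} (F : FiniteField q) where
  open LinAlg F hiding (upTo)
  open FiniteField F using (0#; 1#; inverse; 0≢1)
    renaming (_+_ to _+ᶠ_; _*_ to _*ᶠ_; -_ to -ᶠ_)
  open Gaussian (+ q)

  R : CommutativeRing _ _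
  R = record { isCommutativeRing = FiniteField.isCommRing F }

  open module R = CommutativeRing R using ()
  open Algebra.Properties.Ring R.ring using (-1*x≈-x)

  Q : ℤ
  Q = + q

  private variable
    j k d : ℕ

  ⊕-identityˡ : (v : Vec (Fin q) n) → zeroV ⊕ v ≡ v
  ⊕-identityˡ = Vecₚ.zipWith-identityˡ R.+-identityˡ

  ⊕-identityʳ : (v : Vec (Fin q) n) → v ⊕ zeroV ≡ v
  ⊕-identityʳ = Vecₚ.zipWith-identityʳ R.+-identityʳ

  ⊕-assoc : (u v w : Vec (Fin q) n) → (u ⊕ v) ⊕ w ≡ u ⊕ (v ⊕ w)
  ⊕-assoc = Vecₚ.zipWith-assoc R.+-assoc

  ⊕-comm : (u v : Vec (Fin q) n) → u ⊕ v ≡ v ⊕ u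
  ⊕-comm = Vecₚ.zipWith-comm R.+-comm

  ⊕-interchange : (a b c d : Vec (Fin q) n) → (a ⊕ b) ⊕ (c ⊕ d) ≡ (a ⊕ c) ⊕ (b ⊕ d)
  ⊕-interchange []      []      []      []      = refl
  ⊕-interchange (a ∷ as) (b ∷ bs) (c ∷ cs) (d ∷ ds) =
    cong₂ _∷_ (interchange R.+-commutativeSemigroup a b c d) (⊕-interchange as bs cs ds)

  ·-distribˡ : (a : Fin q) (u v : Vec (Fin q) n) → a · (u ⊕ v) ≡ (a · u) ⊕ (a · v)
  ·-distribˡ a []      []      = refl
  ·-distribˡ a (x ∷ u) (y ∷ v) = cong₂ _∷_ (R.distribˡ a x y) (·-distribˡ a u v)

  ·-distribʳ : (a b : Fin q) (v : Vec (Fin q) n) → (a +ᶠ b) · v ≡ (a · v) ⊕ (b · v)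
  ·-distribʳ a b []      = refl
  ·-distribʳ a b (x ∷ v) = cong₂ _∷_ (R.distribʳ x a b) (·-distribʳ a b v)

  ·-assoc : (a b : Fin q) (v : Vec (Fin q) n) → (a *ᶠ b) · v ≡ a · (b · v)
  ·-assoc a b []      = refl
  ·-assoc a b (x ∷ v) = cong₂ _∷_ (R.*-assoc a b x) (·-assoc a b v)

  ·-identity : (v : Vec (Fin q) n) → 1# · v ≡ v
  ·-identity []      = refl
  ·-identity (x ∷ v) = cong₂ _∷_ (R.*-identityˡ x) (·-identity v)

  ·-zeroˡ : (v : Vec (Fin q) n) → 0# · v ≡ zeroV
  ·-zeroˡ []      = refl
  ·-zeroˡ (x ∷ v) = cong₂ _∷_ (R.zeroˡ x) (·-zeroˡ v)

  ·-zeroʳ : (a : Fin q) → a · zeroV {n} ≡ zeroV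
  ·-zeroʳ {zero}  a = refl
  ·-zeroʳ {suc n} a = cong₂ _∷_ (R.zeroʳ a) (·-zeroʳ a)

  -- As a scalar multiple, negation passes through `lincomb` by `lincomb-·`.
  neg : Vec (Fin q) n → Vec (Fin q) n
  neg v = (-ᶠ 1#) · v

  ⊕-inverseˡ : (v : Vec (Fin q) n) → neg v ⊕ v ≡ zeroV
  ⊕-inverseˡ []      = refl
  ⊕-inverseˡ (x ∷ v) = cong₂ _∷_ (trans (cong (_+ᶠ x) (-1*x≈-x x)) (R.-‿inverseˡ x)) (⊕-inverseˡ v)

  ⊕-inverseʳ : (v : Vec (Fin q) n) → v ⊕ neg v ≡ zeroV
  ⊕-inverseʳ v = trans (⊕-comm v (neg v)) (⊕-inverseˡ v)

  ⊕-neg-cancel : (u v : Vec (Fin q) n) → u ⊕ neg v ≡ zeroV → u ≡ v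
  ⊕-neg-cancel u v e = begin
    u                 ≡⟨ ⊕-identityʳ u ⟨
    u ⊕ zeroV         ≡⟨ cong (u ⊕_) (⊕-inverseˡ v) ⟨
    u ⊕ (neg v ⊕ v)   ≡⟨ ⊕-assoc u (neg v) v ⟨
    (u ⊕ neg v) ⊕ v   ≡⟨ cong (_⊕ v) e ⟩
    zeroV ⊕ v         ≡⟨ ⊕-identityˡ v ⟩
    v                 ∎

  lincomb-zero : (vs : Vec (Vec (Fin q) n) k) → lincomb zeroV vs ≡ zeroV
  lincomb-zero []       = refl
  lincomb-zero (v ∷ vs) = trans (cong₂ _⊕_ (·-zeroˡ v) (lincomb-zero vs)) (⊕-identityˡ zeroV)

  lincomb-⊕ : (c d : Vec (Fin q) k) (vs : Vec (Vec (Fin q) n) k) →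
    lincomb (c ⊕ d) vs ≡ lincomb c vs ⊕ lincomb d vs
  lincomb-⊕ []      []      []       = sym (⊕-identityˡ zeroV)
  lincomb-⊕ (a ∷ c) (b ∷ d) (v ∷ vs) = trans
    (cong₂ _⊕_ (·-distribʳ a b v) (lincomb-⊕ c d vs))
    (⊕-interchange (a · v) (b · v) (lincomb c vs) (lincomb d vs))

  lincomb-· : (a : Fin q) (c : Vec (Fin q) k) (vs : Vec (Vec (Fin q) n) k) →
    lincomb (a · c) vs ≡ a · lincomb c vs
  lincomb-· a []      []       = sym (·-zeroʳ a)
  lincomb-· a (b ∷ c) (v ∷ vs) = trans
    (cong₂ _⊕_ (·-assoc a b v) (lincomb-· a c vs))
    (sym (·-distribˡ a (b · v) (lincomb c vs)))

  ==ᵛ-elim : {u v : Vec (Fin q) n} → u ==ᵛ v ≡ true → u ≡ v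
  ==ᵛ-elim {u = []}    {[]}    e = refl
  ==ᵛ-elim {u = x ∷ u} {y ∷ v} e with x ≟ᶠ y
  ... | yes x≡y = cong₂ _∷_ x≡y (==ᵛ-elim e)

  ==ᵛ-intro : {u v : Vec (Fin q) n} → u ≡ v → u ==ᵛ v ≡ true
  ==ᵛ-intro {u = []}    refl = refl
  ==ᵛ-intro {u = x ∷ u} refl =
    ∧-intro (trans (isYes≗does (x ≟ᶠ x)) (dec-true (x ≟ᶠ x) refl)) (==ᵛ-intro {u = u} refl)

  ∈-vecs : (v : Vec (Fin q) n) → v ∈ vecs n
  ∈-vecs = ∈-allVecs ∈-allFin

  ∑-𝟙-==ᵛ : (u : Vec (Fin q) n) → ∑ (vecs n) (λ v → 𝟙 (u ==ᵛ v)) ≡ 1ℤ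
  ∑-𝟙-==ᵛ {n} u = begin
    ∑ (vecs n) (λ v → 𝟙 (u ==ᵛ v))
      ≡⟨ ∑-cong (vecs n) (𝟙-allV-zipWith _==ᶠ_ u) ⟩
    ∑ (vecs n) (λ v → ∏ (zipWith (λ a b → 𝟙 (a ==ᶠ b)) u v))
      ≡⟨ ∑-allVecs-∏ scalars _ u ⟩
    ∏ (Vec.map (λ a → ∑ scalars (λ b → 𝟙 (a ==ᶠ b))) u)
      ≡⟨ ∏-const u (λ i → ∑-𝟙-≟ (lookup u i)) ⟩
    1ℤ ^ n
      ≡⟨ ℤₚ.^-zeroˡ n ⟩
    1ℤ ∎

  ∑-vecs-1 : ∀ k → ∑ (vecs k) (λ _ → 1ℤ) ≡ Q ^ k
  ∑-vecs-1 zero    = ∑-singleton [] _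
  ∑-vecs-1 (suc k) = begin
    ∑ (vecs (suc k)) (λ _ → 1ℤ)
      ≡⟨ ∑-allVecs scalars k _ ⟩
    ∑ scalars (λ _ → ∑ (vecs k) (λ _ → 1ℤ))
      ≡⟨ ∑-cong scalars (λ _ → trans (∑-vecs-1 k) (sym (ℤₚ.*-identityˡ (Q ^ k)))) ⟩
    ∑ scalars (λ _ → 1ℤ * Q ^ k)
      ≡⟨ ∑-*ʳ scalars _ (Q ^ k) ⟩
    ∑ scalars (λ _ → 1ℤ) * Q ^ k
      ≡⟨ cong (_* Q ^ k) (trans (∑-length scalars) (cong +_ (Listₚ.length-tabulate {n = q} id))) ⟩
    Q * Q ^ k ∎

  _⊆_ : SubsetV n → SubsetV n → Set
  S ⊆ T = ∀ v → S v ≡ true → T v ≡ true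

  ⊆ᵇ-elim : {S T : SubsetV n} → S ⊆ᵇ T ≡ true → S ⊆ T
  ⊆ᵇ-elim e v = ⇒ᵇ-elim (allL-elim e (∈-vecs v))

  ⊆ᵇ-intro : {S T : SubsetV n} → S ⊆ T → S ⊆ᵇ T ≡ true
  ⊆ᵇ-intro {n} f = allL-intro (vecs n) (λ v → ⇒ᵇ-intro (f v))

  record Subspace (S : SubsetV n) : Set where
    field
      has-zero : S zeroV ≡ true
      has-⊕    : ∀ u v → S u ≡ true → S v ≡ true → S (u ⊕ v) ≡ true
      has-·    : ∀ a v → S v ≡ true → S (a · v) ≡ true

  subspace-elim : {S : SubsetV n} → isSubspace S ≡ true → Subspace S
  subspace-elim {n} {S} e
    with z , e′ ← ∧-true {S zeroV} e
    with p , m ← ∧-true {allL (λ u → allL (λ v → (S u ∧ S v) ⇒ᵇ S (u ⊕ v)) (vecs n)) (vecs n)} e′ = record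
    { has-zero = z
    ; has-⊕    = λ u v Su Sv → ⇒ᵇ-elim (allL-elim (allL-elim p (∈-vecs u)) (∈-vecs v)) (∧-intro Su Sv)
    ; has-·    = λ a v → ⇒ᵇ-elim (allL-elim (allL-elim m (∈-allFin a)) (∈-vecs v))
    }

  subspace-intro : {S : SubsetV n} → Subspace S → isSubspace S ≡ true
  subspace-intro {n} sub = ∧-intro has-zero (∧-intro
    (allL-intro (vecs n) (λ u → allL-intro (vecs n) (λ v → ⇒ᵇ-intro (λ e → has-⊕ u v (proj₁ (∧-true e)) (proj₂ (∧-true e))))))
    (allL-intro scalars (λ a → allL-intro (vecs n) (λ v → ⇒ᵇ-intro (has-· a v)))))
    where open Subspace sub

  lincomb-closed : {S : SubsetV n} → Subspace S → (c : Vec (Fin q) k) (vs : Vec (Vec (Fin q) n) k) →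
    allV S vs ≡ true → S (lincomb c vs) ≡ true
  lincomb-closed sub []      []       e = Subspace.has-zero sub
  lincomb-closed sub (a ∷ c) (v ∷ vs) e = Subspace.has-⊕ sub _ _
    (Subspace.has-· sub a v (proj₁ (∧-true e))) (lincomb-closed sub c vs (proj₂ (∧-true e)))

  -- Repeats the test inside `spans`, so that `spans vs S` is by computation `S ⊆ᵇ span vs`.
  span : Vec (Vec (Fin q) n) k → SubsetV n
  span {k = k} vs v = anyL (λ c → lincomb c vs ==ᵛ v) (vecs k)

  span-elim : (vs : Vec (Vec (Fin q) n) k) {v : Vec (Fin q) n} → span vs v ≡ true → ∃ λ c → lincomb c vs ≡ v
  span-elim {k = k} vs e with c , p ← anyL-elim (vecs k) e = c , ==ᵛ-elim p

  span-intro : (vs : Vec (Vec (Fin q) n) k) (c : Vec (Fin q) k) → span vs (lincomb c vs) ≡ true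
  span-intro vs c = anyL-intro (∈-vecs c) (==ᵛ-intro {u = lincomb c vs} refl)

  span-⊆ : {S : SubsetV n} (vs : Vec (Vec (Fin q) n) k) → Subspace S → allV S vs ≡ true → span vs ⊆ S
  span-⊆ vs sub e v p with c , refl ← span-elim vs p = lincomb-closed sub c vs e

  span-subspace : (vs : Vec (Vec (Fin q) n) k) → Subspace (span vs)
  span-subspace vs = record
    { has-zero = subst (λ v → span vs v ≡ true) (lincomb-zero vs) (span-intro vs zeroV)
    ; has-⊕    = λ u v Su Sv → plus Su Sv
    ; has-·    = λ a v Sv → times a Sv
    }
    where
    plus : ∀ {u v} → span vs u ≡ true → span vs v ≡ true → span vs (u ⊕ v) ≡ true
    plus Su Sv with c , refl ← span-elim vs Su | d , refl ← span-elim vs Sv =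
      subst (λ v → span vs v ≡ true) (lincomb-⊕ c d vs) (span-intro vs (c ⊕ d))
    times : ∀ a {v} → span vs v ≡ true → span vs (a · v) ≡ true
    times a Sv with c , refl ← span-elim vs Sv =
      subst (λ v → span vs v ≡ true) (lincomb-· a c vs) (span-intro vs (a · c))

  span-generators : (vs : Vec (Vec (Fin q) n) k) → allV (span vs) vs ≡ true
  span-generators []       = refl
  span-generators (v ∷ vs) = ∧-intro
    (subst (λ u → span (v ∷ vs) u ≡ true) head (span-intro (v ∷ vs) (1# ∷ zeroV)))
    (allV-intro vs (λ i → weaken (allV-elim vs (span-generators vs) i)))
    where
    head : lincomb (1# ∷ zeroV) (v ∷ vs) ≡ v
    head = trans (cong₂ _⊕_ (·-identity v) (lincomb-zero vs)) (⊕-identityʳ v)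
    weaken : ∀ {u} → span vs u ≡ true → span (v ∷ vs) u ≡ true
    weaken {u} p with c , refl ← span-elim vs p = subst (λ u → span (v ∷ vs) u ≡ true)
      (trans (cong (_⊕ lincomb c vs) (·-zeroˡ v)) (⊕-identityˡ _)) (span-intro (v ∷ vs) (0# ∷ c))

  independent-elim : (vs : Vec (Vec (Fin q) n) k) → independent vs ≡ true →
    ∀ c → lincomb c vs ≡ zeroV → c ≡ zeroV
  independent-elim vs e c p = ==ᵛ-elim (⇒ᵇ-elim (allL-elim e (∈-vecs c)) (==ᵛ-intro p))

  independent-intro : (vs : Vec (Vec (Fin q) n) k) → (∀ c → lincomb c vs ≡ zeroV → c ≡ zeroV) →
    independent vs ≡ true
  independent-intro {k = k} vs f = allL-intro (vecs k) (λ c → ⇒ᵇ-intro (λ e → ==ᵛ-intro (f c (==ᵛ-elim e))))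

  lincomb-injective : (vs : Vec (Vec (Fin q) n) k) → independent vs ≡ true →
    ∀ c d → lincomb c vs ≡ lincomb d vs → c ≡ d
  lincomb-injective vs ind c d e = ⊕-neg-cancel c d (independent-elim vs ind (c ⊕ neg d) (begin
    lincomb (c ⊕ neg d) vs              ≡⟨ lincomb-⊕ c (neg d) vs ⟩
    lincomb c vs ⊕ lincomb (neg d) vs   ≡⟨ cong₂ _⊕_ e (lincomb-· (-ᶠ 1#) d vs) ⟩
    lincomb d vs ⊕ neg (lincomb d vs)   ≡⟨ ⊕-inverseʳ _ ⟩
    zeroV                               ∎))

  -- Allows independent tuples to be counted vector by vector: a new vector has to avoid the span of
  -- the others.
  independent-∷ : (v : Vec (Fin q) n) (vs : Vec (Vec (Fin q) n) k) →
    independent (v ∷ vs) ≡ independent vs ∧ not (span vs v)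
  independent-∷ v vs = bool-ext
    (λ e → ∧-intro
      (independent-intro vs (λ c p → Vecₚ.∷-injectiveʳ (independent-elim (v ∷ vs) e (0# ∷ c)
        (trans (cong₂ _⊕_ (·-zeroˡ v) p) (⊕-identityˡ zeroV)))))
      (not-intro (dependent e)))
    (λ e → independent-intro (v ∷ vs) (λ { (a ∷ c) p →
      extend a c (proj₁ (∧-true e)) (not-elim (proj₂ (∧-true {independent vs} e))) p }))
    where
    dependent : independent (v ∷ vs) ≡ true → ¬ span vs v ≡ true
    dependent e p with c , q ← span-elim vs p =
      0≢1 (sym 1≡0)
      where
      -1≡0 : -ᶠ 1# ≡ 0#
      -- If `v` is `lincomb c vs`, the relation with coefficient -1 at `v` and `c` elsewhere gives
      -- zero.
      -1≡0 = Vecₚ.∷-injectiveˡ (independent-elim (v ∷ vs) e ((-ᶠ 1#) ∷ c)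
        (trans (cong (neg v ⊕_) q) (⊕-inverseˡ v)))
      1≡0 : 1# ≡ 0#
      1≡0 = begin
        1#             ≡⟨ R.+-identityʳ 1# ⟨
        1# +ᶠ 0#       ≡⟨ cong (1# +ᶠ_) -1≡0 ⟨
        1# +ᶠ (-ᶠ 1#)  ≡⟨ R.-‿inverseʳ 1# ⟩
        0#             ∎
    extend : ∀ a c → independent vs ≡ true → ¬ span vs v ≡ true →
      (a · v) ⊕ lincomb c vs ≡ zeroV → a ∷ c ≡ zeroV
    extend a c ind v∉ p with a ≟ᶠ 0#
    ... | yes refl = cong (0# ∷_) (independent-elim vs ind c
      (trans (sym (trans (cong (_⊕ lincomb c vs) (·-zeroˡ v)) (⊕-identityˡ _))) p))
    ... | no a≢0 with b , ab≡1 ← inverse a a≢0 =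
      -- With `a` invertible the relation is solved for `v`, whose coefficients are the negatives of
      -- `c` divided by `a`.
      contradiction (subst (λ u → span vs u ≡ true) solved (span-intro vs (b · neg c))) v∉
      where
      solved : lincomb (b · neg c) vs ≡ v
      solved = begin
        lincomb (b · neg c) vs
          ≡⟨ trans (lincomb-· b (neg c) vs) (cong (b ·_) (lincomb-· (-ᶠ 1#) c vs)) ⟩
        b · neg (lincomb c vs)
          ≡⟨ cong (b ·_) (⊕-identityˡ _) ⟨
        b · (zeroV ⊕ neg (lincomb c vs))
          ≡⟨ cong (λ z → b · (z ⊕ neg (lincomb c vs))) p ⟨
        b · (((a · v) ⊕ lincomb c vs) ⊕ neg (lincomb c vs))
          ≡⟨ cong (b ·_) (trans (⊕-assoc _ _ _) (cong ((a · v) ⊕_) (⊕-inverseʳ _))) ⟩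
        b · ((a · v) ⊕ zeroV)
          ≡⟨ cong (b ·_) (⊕-identityʳ (a · v)) ⟩
        b · (a · v)
          ≡⟨ ·-assoc b a v ⟨
        (b *ᶠ a) · v
          ≡⟨ cong (_· v) (trans (R.*-comm b a) ab≡1) ⟩
        1# · v
          ≡⟨ ·-identity v ⟩
        v ∎

  -- Cardinality as a measure of dimension

  size : SubsetV n → ℤ
  size {n} S = ∑ (vecs n) (𝟙 ∘ S)

  size-difference : {S T : SubsetV n} → S ⊆ T →
    ∑ (vecs n) (λ v → 𝟙 (T v ∧ not (S v))) ≡ size T - size S
  size-difference {n} {S} {T} S⊆T = trans (∑-cong (vecs n) pointwise) (∑-- (vecs n) (𝟙 ∘ T) (𝟙 ∘ S))
    where
    pointwise : ∀ v → 𝟙 (T v ∧ not (S v)) ≡ 𝟙 (T v) - 𝟙 (S v)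
    pointwise v with S v in p | T v in r
    ... | true  | true  = refl
    ... | false | true  = refl
    ... | false | false = refl
    ... | true  | false with () ← trans (sym (S⊆T v p)) r

  -- The difference of `T` and `S` has size 0, so no vector lies in it.
  ⊇-of-size : {S T : SubsetV n} → S ⊆ T → size S ≡ size T → T ⊆ S
  ⊇-of-size {n} {S} {T} S⊆T e v Tv
    with S v | ∑-𝟙-zero _ (vecs n) (trans (size-difference S⊆T) (trans (cong (_-_ (size T)) e) (ℤₚ.+-inverseʳ (size T)))) (∈-vecs v)
  ... | true  | _ = refl
  ... | false | f with () ← trans (sym (∧-intro Tv refl)) f

  size-antisym : {S T : SubsetV n} → S ⊆ T → T ⊆ S → size S ≡ size T
  size-antisym {n} S⊆T T⊆S = ∑-cong (vecs n) (λ v → cong 𝟙 (bool-ext (S⊆T v) (T⊆S v)))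

  -- By independence a vector of the span comes from exactly one coefficient vector, so its
  -- indicator is the number of these; exchanging the sums leaves the count of all coefficient
  -- vectors.
  size-span : (vs : Vec (Vec (Fin q) n) k) → independent vs ≡ true → size (span vs) ≡ Q ^ k
  size-span {n} {k} vs ind = begin
    ∑ (vecs n) (𝟙 ∘ span vs)
      ≡⟨ ∑-cong (vecs n) unique ⟩
    ∑ (vecs n) (λ v → ∑ (vecs k) (λ c → 𝟙 (lincomb c vs ==ᵛ v)))
      ≡⟨ ∑-swap (vecs n) (vecs k) _ ⟩
    ∑ (vecs k) (λ c → ∑ (vecs n) (λ v → 𝟙 (lincomb c vs ==ᵛ v)))
      ≡⟨ ∑-cong (vecs k) (λ c → ∑-𝟙-==ᵛ (lincomb c vs)) ⟩
    ∑ (vecs k) (λ _ → 1ℤ)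
      ≡⟨ ∑-vecs-1 k ⟩
    Q ^ k ∎
    where
    unique : ∀ v → 𝟙 (span vs v) ≡ ∑ (vecs k) (λ c → 𝟙 (lincomb c vs ==ᵛ v))
    unique v with span vs v in eq
    ... | false = sym (trans (∑-cong (vecs k) (λ c → cong 𝟙 (absent c))) (∑-zero (vecs k)))
      where
      absent : ∀ c → lincomb c vs ==ᵛ v ≡ false
      absent c with lincomb c vs ==ᵛ v in p
      ... | false = refl
      ... | true with () ← trans (sym (anyL-intro (∈-vecs c) p)) eq
    ... | true with c₀ , refl ← span-elim vs eq = sym (trans
      (∑-cong (vecs k) (λ c → cong 𝟙 (bool-ext
        (λ p → ==ᵛ-intro (lincomb-injective vs ind c₀ c (sym (==ᵛ-elim p))))
        (λ p → ==ᵛ-intro (cong (λ c → lincomb c vs) (sym (==ᵛ-elim {u = c₀} {c} p)))))))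
      (∑-𝟙-==ᵛ c₀))

  -- `hasDim` only asserts that some basis exists; the cardinality is determined by the subset, and
  -- it is what the later arguments compare.
  hasDim-size : {S : SubsetV n} → Subspace S → hasDim S k ≡ true → size S ≡ Q ^ k
  hasDim-size {n} {k} {S} sub e with vs , p ← anyL-elim (allVecs (vecs n) k) e = trans
    (size-antisym S⊆span (span-⊆ vs sub (proj₁ (∧-true p))))
    (size-span vs (proj₁ (∧-true (proj₂ (∧-true {allV S vs} p)))))
    where
    S⊆span : S ⊆ span vs
    S⊆span v = ⇒ᵇ-elim (allL-elim (proj₂ (∧-true {independent vs} (proj₂ (∧-true {allV S vs} p)))) (∈-vecs v))

  1<q : 1 < q
  1<q = two 0# 1# 0≢1
    where
    two : ∀ {m} (a b : Fin m) → a ≢ b → 1 < m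
    two {suc zero}    zero zero a≢b = contradiction refl a≢b
    two {suc (suc m)} _    _    _   = s≤s (s≤s z≤n)

  -- The size of `T` exceeds that of `S` by the natural number `c` of vectors in the difference, so
  -- `q ^ j ≤ q ^ d`, and `1 < q` carries this to the exponents.
  dim-mono : {S T : SubsetV n} → S ⊆ T → size S ≡ Q ^ j → size T ≡ Q ^ d → j ≤ d
  dim-mono {n} {j} {d} {S} {T} S⊆T eS eT = ℕₚ.≮⇒≥ (λ d<j → ℕₚ.<⇒≱ (ℕₚ.^-monoʳ-< q 1<q d<j) q^j≤q^d)
    where
    c : ℕ
    c = countL (λ v → T v ∧ not (S v)) (vecs n)
    lemma : ∀ x y → x ≡ y + (x - y)
    lemma = solve-∀
    q^j≤q^d : q ℕ.^ j ≤ q ℕ.^ d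
    q^j≤q^d = subst (q ℕ.^ j ≤_) (ℤₚ.+-injective (begin
      + (q ℕ.^ j ℕ.+ c)        ≡⟨ ℤₚ.pos-+ (q ℕ.^ j) c ⟩
      + (q ℕ.^ j) + + c        ≡⟨ cong₂ _+_ (trans (pos-^ q j) (sym eS)) (trans (countL-∑ _ (vecs n)) (size-difference S⊆T)) ⟩
      size S + (size T - size S) ≡⟨ lemma (size T) (size S) ⟨
      size T                   ≡⟨ trans eT (sym (pos-^ q d)) ⟩
      + (q ℕ.^ d)              ∎)) (ℕₚ.m≤m+n (q ℕ.^ j) c)

  Q^-injective : Q ^ j ≡ Q ^ d → j ≡ d
  Q^-injective {j} {d} e = ℕₚ.≤-antisym (half e) (half (sym e))
    where
    half : ∀ {j d} → Q ^ j ≡ Q ^ d → j ≤ d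
    half {j} {d} e = ℕₚ.≮⇒≥ (λ d<j → ℕₚ.<⇒≢ (ℕₚ.^-monoʳ-< q 1<q d<j)
      (ℤₚ.+-injective (trans (pos-^ q d) (trans (sym e) (sym (pos-^ q j))))))

  -- Each factor `q ^ d - q ^ i` has `i < d`, and powers of `q` with distinct exponents differ.
  frames-nonzero : j ≤ d → frames d j ≢ 0ℤ
  frames-nonzero {zero}  j≤d ()
  frames-nonzero {suc j} {d} j<d e with ℤₚ.i*j≡0⇒i≡0∨j≡0 (frames d j) e
  ... | inj₁ p = frames-nonzero (ℕₚ.<⇒≤ j<d) p
  ... | inj₂ p = ℕₚ.<⇒≢ j<d (sym (Q^-injective (ℤₚ.i-j≡0⇒i≡j (Q ^ d) (Q ^ j) p)))

  -- Counting subspaces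

  -- Counts ordered independent `j`-tuples inside `S`; they are its bases when `S` has dimension
  -- `j`.
  bases : SubsetV n → ℕ → ℤ
  bases {n} S j = ∑ (allVecs (vecs n) j) (λ vs → 𝟙 (allV S vs ∧ independent vs))

  -- An independent `j`-tuple in `S` spans `q ^ j` of the `q ^ d` vectors of `S`, and each of the
  -- others extends it.
  bases-frames : {S : SubsetV n} → Subspace S → size S ≡ Q ^ d → ∀ j → bases S j ≡ frames d j
  bases-frames {n} sub e zero = trans (∑-singleton [] _) (cong 𝟙 (independent-intro {n} [] (λ { [] _ → refl })))
  bases-frames {n} {d} {S} sub e (suc j) = begin
    ∑ (allVecs (vecs n) (suc j)) (λ vs → 𝟙 (allV S vs ∧ independent vs))
      ≡⟨ ∑-allVecs (vecs n) j _ ⟩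
    ∑ (vecs n) (λ v → ∑ Vs (λ vs → 𝟙 ((S v ∧ allV S vs) ∧ independent (v ∷ vs))))
      ≡⟨ ∑-swap (vecs n) Vs _ ⟩
    ∑ Vs (λ vs → ∑ (vecs n) (λ v → 𝟙 ((S v ∧ allV S vs) ∧ independent (v ∷ vs))))
      ≡⟨ ∑-cong Vs (λ vs → trans (∑-cong (vecs n) (λ v → split v vs)) (∑-*ˡ (vecs n) (𝟙 (allV S vs ∧ independent vs)) _)) ⟩
    ∑ Vs (λ vs → 𝟙 (allV S vs ∧ independent vs) * ∑ (vecs n) (λ v → 𝟙 (S v ∧ not (span vs v))))
      ≡⟨ ∑-cong Vs (λ vs → 𝟙-guard (allV S vs ∧ independent vs) (λ p → trans
           (size-difference (span-⊆ vs sub (proj₁ (∧-true p))))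
           (cong₂ _-_ e (size-span vs (proj₂ (∧-true {allV S vs} p)))))) ⟩
    ∑ Vs (λ vs → 𝟙 (allV S vs ∧ independent vs) * (Q ^ d - Q ^ j))
      ≡⟨ ∑-*ʳ Vs _ _ ⟩
    bases S j * (Q ^ d - Q ^ j)
      ≡⟨ cong (_* (Q ^ d - Q ^ j)) (bases-frames sub e j) ⟩
    frames d (suc j) ∎
    where
    Vs : List (Vec (Vec (Fin q) n) j)
    Vs = allVecs (vecs n) j
    regroup : ∀ a b c d → (a ∧ b) ∧ (c ∧ d) ≡ (b ∧ c) ∧ (a ∧ d)
    regroup true  b c d     = sym (Boolₚ.∧-assoc b c d)
    regroup false b c d     = sym (Boolₚ.∧-zeroʳ (b ∧ c))
    split : ∀ v vs → 𝟙 ((S v ∧ allV S vs) ∧ independent (v ∷ vs)) ≡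
      𝟙 (allV S vs ∧ independent vs) * 𝟙 (S v ∧ not (span vs v))
    split v vs = trans
      (cong 𝟙 (trans (cong ((S v ∧ allV S vs) ∧_) (independent-∷ v vs)) (regroup (S v) (allV S vs) (independent vs) (not (span vs v)))))
      (𝟙-∧ (allV S vs ∧ independent vs) _)

  -- A Boolean form of pointwise equality. It recurses along the first coordinate like `Table`, so
  -- that counting the tables that agree with a given subset splits into independent counts over
  -- slices.
  agree : SubsetV n → SubsetV n → Bool
  agree {zero}  S T = S [] ==ᵇ T []
  agree {suc n} S T = allV id (Vec.tabulate (λ x → agree (λ v → S (x ∷ v)) (λ v → T (x ∷ v))))

  agree-elim : {S T : SubsetV n} → agree S T ≡ true → ∀ v → S v ≡ T v
  agree-elim {zero}  e []      = ==ᵇ-elim e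
  agree-elim {suc n} e (x ∷ v) = agree-elim (trans (sym (Vecₚ.lookup∘tabulate _ x)) (allV-elim (Vec.tabulate _) e x)) v

  agree-intro : {S T : SubsetV n} → (∀ v → S v ≡ T v) → agree S T ≡ true
  agree-intro {zero}  f = ==ᵇ-intro (f [])
  agree-intro {suc n} f = allV-intro (Vec.tabulate _) (λ x → trans (Vecₚ.lookup∘tabulate _ x) (agree-intro (λ v → f (x ∷ v))))

  -- Up to pointwise equality every subset is listed exactly once: a table is a choice of one table
  -- for each of the `q` slices, each unique by induction.
  ∑-agree : (T : SubsetV n) → ∑ (allSubsets n) (λ S → 𝟙 (agree S T)) ≡ 1ℤ
  ∑-agree {n} T = trans (∑-map member (allTables n) _) (tables T)
    where
    tables : ∀ {n} (T : SubsetV n) → ∑ (allTables n) (λ t → 𝟙 (agree (member t) T)) ≡ 1ℤ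
    tables {zero} T = trans (∑-∷ true (false ∷ []) _) (trans (cong (_+_ (𝟙 (T []))) (∑-singleton false _)) (one (T [])))
      where
      one : ∀ b → 𝟙 b + 𝟙 (not b) ≡ 1ℤ
      one true  = refl
      one false = refl
    tables {suc n} T = begin
      ∑ (allVecs (allTables n) q) (λ t → 𝟙 (allV id (Vec.tabulate (λ x → agree (member (lookup t x)) (slice x)))))
        ≡⟨ ∑-cong (allVecs (allTables n) q) factor ⟩
      ∑ (allVecs (allTables n) q) (λ t → ∏ (zipWith g (Vec.allFin q) t))
        ≡⟨ ∑-allVecs-∏ (allTables n) g (Vec.allFin q) ⟩
      ∏ (Vec.map (λ x → ∑ (allTables n) (g x)) (Vec.allFin q))
        ≡⟨ ∏-const (Vec.allFin q) (λ x → tables (slice (lookup (Vec.allFin q) x))) ⟩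
      1ℤ ^ q
        ≡⟨ ℤₚ.^-zeroˡ q ⟩
      1ℤ ∎
      where
      slice : Fin q → SubsetV n
      slice x v = T (x ∷ v)
      g : Fin q → Table n → ℤ
      g x t = 𝟙 (agree (member t) (slice x))
      factor : ∀ t → 𝟙 (allV id (Vec.tabulate (λ x → agree (member (lookup t x)) (slice x)))) ≡ ∏ (zipWith g (Vec.allFin q) t)
      factor t = trans (𝟙-allV id (Vec.tabulate (λ x → agree (member (lookup t x)) (slice x))))
        (cong ∏ (trans (sym (Vecₚ.tabulate-∘ 𝟙 _)) (tabulate-zipWith g t)))

  below : SubsetV n → ℕ → SubsetV n → Bool
  below Y j S = (isSubspace S ∧ hasDim S j) ∧ (S ⊆ᵇ Y)

  -- Double counting of the pairs (S, basis of S).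
  below-frames : {Y : SubsetV n} → Subspace Y → size Y ≡ Q ^ d → ∀ j →
    ∑ (allSubsets n) (𝟙 ∘ below Y j) * frames j j ≡ frames d j
  below-frames {n} {d} {Y} sub e j = begin
    ∑ (allSubsets n) (𝟙 ∘ below Y j) * frames j j
      ≡⟨ ∑-*ʳ (allSubsets n) _ _ ⟨
    ∑ (allSubsets n) (λ S → 𝟙 (below Y j S) * frames j j)
      ≡⟨ ∑-cong (allSubsets n) (λ S → 𝟙-guard (below Y j S) (λ p → sym (count S p))) ⟩
    ∑ (allSubsets n) (λ S → 𝟙 (below Y j S) * bases S j)
      ≡⟨ ∑-cong (allSubsets n) (λ S → sym (∑-*ˡ Vs (𝟙 (below Y j S)) _)) ⟩
    ∑ (allSubsets n) (λ S → ∑ Vs (λ vs → 𝟙 (below Y j S) * 𝟙 (allV S vs ∧ independent vs)))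
      ≡⟨ ∑-swap (allSubsets n) Vs _ ⟩
    ∑ Vs (λ vs → ∑ (allSubsets n) (λ S → 𝟙 (below Y j S) * 𝟙 (allV S vs ∧ independent vs)))
      ≡⟨ ∑-cong Vs (λ vs → trans (∑-cong (allSubsets n) (spanned vs)) (trans (∑-*ˡ (allSubsets n) (𝟙 (allV Y vs ∧ independent vs)) _)
           (trans (cong (𝟙 (allV Y vs ∧ independent vs) *_) (∑-agree (span vs))) (ℤₚ.*-identityʳ _)))) ⟩
    bases Y j
      ≡⟨ bases-frames sub e j ⟩
    frames d j ∎
    where
    Vs : List (Vec (Vec (Fin q) n) j)
    Vs = allVecs (vecs n) j
    below-elim : ∀ S → below Y j S ≡ true → Subspace S × size S ≡ Q ^ j × S ⊆ Y
    below-elim S p with u , S⊆Y ← ∧-true {isSubspace S ∧ hasDim S j} p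
                   with s , dim ← ∧-true {isSubspace S} u =
      subspace-elim s , hasDim-size {k = j} (subspace-elim s) dim , ⊆ᵇ-elim S⊆Y
    count : ∀ S → below Y j S ≡ true → bases S j ≡ frames j j
    count S p with s , sz , _ ← below-elim S p = bases-frames s sz j
    -- For a fixed independent tuple in `Y`, the only subspace of dimension `j` containing it is its
    -- span.
    spanned : ∀ vs S → 𝟙 (below Y j S) * 𝟙 (allV S vs ∧ independent vs) ≡
      𝟙 (allV Y vs ∧ independent vs) * 𝟙 (agree S (span vs))
    spanned vs S = trans (sym (𝟙-∧ (below Y j S) _)) (trans (cong 𝟙 (bool-ext to from)) (𝟙-∧ (allV Y vs ∧ independent vs) _))
      where
      to : below Y j S ∧ (allV S vs ∧ independent vs) ≡ true → (allV Y vs ∧ independent vs) ∧ agree S (span vs) ≡ true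
      to p with b , u ← ∧-true {below Y j S} p
           with Svs , ind ← ∧-true {allV S vs} u
           with s , sz , S⊆Y ← below-elim S b = ∧-intro
        (∧-intro (allV-intro vs (λ i → S⊆Y _ (allV-elim vs Svs i))) ind)
        -- `span vs` lies in `S` and both have `q ^ j` elements.
        (agree-intro (λ v → bool-ext (⊇-of-size span⊆S (trans (size-span vs ind) (sym sz)) v) (span⊆S v)))
        where
        span⊆S : span vs ⊆ S
        span⊆S = span-⊆ vs s Svs
      from : (allV Y vs ∧ independent vs) ∧ agree S (span vs) ≡ true → below Y j S ∧ (allV S vs ∧ independent vs) ≡ true
      from p with u , a ← ∧-true {allV Y vs ∧ independent vs} p
             with Yvs , ind ← ∧-true {allV Y vs} u = ∧-intro
        (∧-intro (∧-intro (subspace-intro S-sub)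
          (anyL-intro (∈-allVecs ∈-vecs vs) (∧-intro Svs (∧-intro ind (⊆ᵇ-intro (λ v Sv → trans (sym (same v)) Sv))))))
          (⊆ᵇ-intro (λ v Sv → span-⊆ vs sub Yvs v (trans (sym (same v)) Sv))))
        (∧-intro Svs ind)
        where
        same : ∀ v → S v ≡ span vs v
        same = agree-elim a
        Svs : allV S vs ≡ true
        Svs = trans (allV-cong vs same) (span-generators vs)
        S-sub : Subspace S
        S-sub = record
          { has-zero = trans (same _) has-zero
          ; has-⊕    = λ u v p r → trans (same _) (has-⊕ u v (trans (sym (same u)) p) (trans (sym (same v)) r))
          ; has-·    = λ b v p → trans (same _) (has-· b v (trans (sym (same v)) p))
          }
          where open Subspace (span-subspace vs)

  -- The subspace count and the chain sum both become `frames d j` after multiplication by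
  -- `frames j j`, which cancels.
  ∑-below-gauss : {Y : SubsetV n} → Subspace Y → size Y ≡ Q ^ d → j ≤ d →
    ∑ (allSubsets n) (𝟙 ∘ below Y j) ≡ gauss (d ℕ.∸ j) j
  ∑-below-gauss {n} {d} {j} {Y} sub e j≤d = ℤₚ.*-cancelʳ-≡ _ _ (frames j j) ⦃ ℤ.≢-nonZero (frames-nonzero (ℕₚ.≤-refl {j})) ⦄ (begin
    ∑ (allSubsets n) (𝟙 ∘ below Y j) * frames j j  ≡⟨ below-frames sub e j ⟩
    frames d j                                     ≡⟨ cong (λ d → frames d j) (ℕₚ.m+[n∸m]≡n j≤d) ⟨
    frames (j ℕ.+ (d ℕ.∸ j)) j                     ≡⟨ gauss-frames (d ℕ.∸ j) j ⟨
    gauss (d ℕ.∸ j) j * frames j j                 ∎)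

-- The Möbius recursion on tuples of subspaces

allV-zipWith-elim : {p : A → C → Bool} (u : Vec A n) (v : Vec C n) →
  allV id (zipWith p u v) ≡ true → ∀ i → p (lookup u i) (lookup v i) ≡ true
allV-zipWith-elim {p = p} u v e i = trans (sym (Vecₚ.lookup-zipWith p i u v)) (allV-elim (zipWith p u v) e i)

allV-zipWith-intro : {p : A → C → Bool} (u : Vec A n) (v : Vec C n) →
  (∀ i → p (lookup u i) (lookup v i) ≡ true) → allV id (zipWith p u v) ≡ true
allV-zipWith-intro {p = p} u v f = allV-intro (zipWith p u v) (λ i → trans (Vecₚ.lookup-zipWith p i u v) (f i))

-- There are t + 1 factors: with none, tuples would have no dimension.
module MöbiusFunction {q : ℕ} (F : FiniteField q) (n t : ℕ) where
  open LinAlg F hiding (upTo)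
  open Counting F
  open Gaussian (+ q)
  open CodeSums (+ q) (suc t)
  open Möbius (elems n (suc t)) _≤ᴮ_

  private variable
    j k d : ℕ

  Tuple : Set
  Tuple = Elem n (suc t)

  tuples : List Tuple
  tuples = allVecs (allSubsets n) (suc t)

  ⊥ᴮ : Tuple
  ⊥ᴮ = bottom n (suc t)

  ⊤ᴮ : Tuple
  ⊤ᴮ = top n (suc t)

  -- Dimension is recorded through sizes, so bottom and top fit without exhibiting bases.
  record HasDims (Z : Tuple) (d : ℕ) : Set where
    constructor dims
    field
      subspaces : ∀ i → Subspace (lookup Z i)
      sizes     : ∀ i → size (lookup Z i) ≡ Q ^ d
  open HasDims

  ≤ᴮ-elim : (Y Z : Tuple) → Y ≤ᴮ Z ≡ true → ∀ i → lookup Y i ⊆ lookup Z i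
  ≤ᴮ-elim Y Z e i = ⊆ᵇ-elim (allV-zipWith-elim Y Z e i)

  ≤ᴮ-intro : (Y Z : Tuple) → (∀ i → lookup Y i ⊆ lookup Z i) → Y ≤ᴮ Z ≡ true
  ≤ᴮ-intro Y Z f = allV-zipWith-intro Y Z (λ i → ⊆ᵇ-intro (f i))

  Components : Tuple → ℕ → Set
  Components Z k = ∀ i → isSubspace (lookup Z i) ≡ true × hasDim (lookup Z i) k ≡ true

  isElem-elim : (Z : Tuple) → isElem Z ≡ true → ∃ (Components Z)
  isElem-elim Z e with s , h ← ∧-true {allV isSubspace Z} e
                  with k , dim ← anyL-elim (upTo (suc n)) h =
    k , λ i → allV-elim Z s i , allV-elim Z dim i

  isElem-intro : (Z : Tuple) → k ≤ n → Components Z k → isElem Z ≡ true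
  isElem-intro Z k≤n f = ∧-intro (allV-intro Z (proj₁ ∘ f))
    (anyL-intro (∈-upTo⁺ (s≤s k≤n)) (allV-intro Z (proj₂ ∘ f)))

  hasDims : (Z : Tuple) (k : ℕ) → Components Z k → HasDims Z k
  hasDims Z k f = dims (λ i → subspace-elim (proj₁ (f i)))
    (λ i → hasDim-size {k = k} (subspace-elim (proj₁ (f i))) (proj₂ (f i)))

  allBelow : Tuple → ℕ → Tuple → Bool
  allBelow Y j Z = allV id (zipWith (λ S → below S j) Y Z)

  allBelow-elim : (Y : Tuple) (j : ℕ) (Z : Tuple) → allBelow Y j Z ≡ true → Components Z j × Z ≤ᴮ Y ≡ true
  allBelow-elim Y j Z e =
    (λ i → ∧-true {isSubspace (lookup Z i)} (proj₁ (parts i))) ,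
    ≤ᴮ-intro Z Y (λ i → ⊆ᵇ-elim (proj₂ (parts i)))
    where
    parts : ∀ i → isSubspace (lookup Z i) ∧ hasDim (lookup Z i) j ≡ true × lookup Z i ⊆ᵇ lookup Y i ≡ true
    parts i = ∧-true {isSubspace (lookup Z i) ∧ hasDim (lookup Z i) j} (allV-zipWith-elim Y Z e i)

  allBelow-intro : (Y : Tuple) (j : ℕ) (Z : Tuple) → Components Z j → Z ≤ᴮ Y ≡ true → allBelow Y j Z ≡ true
  allBelow-intro Y j Z f Z≤Y = allV-zipWith-intro Y Z (λ i →
    ∧-intro (∧-intro (proj₁ (f i)) (proj₂ (f i))) (⊆ᵇ-intro (≤ᴮ-elim Z Y Z≤Y i)))

  allBelow-dims : (Y : Tuple) (j : ℕ) (Z : Tuple) → allBelow Y j Z ≡ true → HasDims Z j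
  allBelow-dims Y j Z b = hasDims Z j (proj₁ (allBelow-elim Y j Z b))

  dims-mono : {Y Z : Tuple} → HasDims Y j → HasDims Z d → Y ≤ᴮ Z ≡ true → j ≤ d
  dims-mono {Y = Y} {Z} hY hZ Y≤Z = dim-mono (≤ᴮ-elim Y Z Y≤Z zero) (sizes hY zero) (sizes hZ zero)

  dims-unique : {Z : Tuple} → HasDims Z j → HasDims Z d → j ≡ d
  dims-unique hj hd = Q^-injective (trans (sym (sizes hj zero)) (sizes hd zero))

  ≥ᴮ-of-dims : {Y Z : Tuple} → HasDims Y d → HasDims Z d → Y ≤ᴮ Z ≡ true → Z ≤ᴮ Y ≡ true
  ≥ᴮ-of-dims {Y = Y} {Z} hY hZ Y≤Z = ≤ᴮ-intro Z Y (λ i →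
    ⊇-of-size (≤ᴮ-elim Y Z Y≤Z i) (trans (sizes hY i) (sym (sizes hZ i))))

  -- Once the dimension is fixed, the components are chosen independently.
  ∑-allBelow : {Y : Tuple} → HasDims Y d → j ≤ d →
    ∑ tuples (𝟙 ∘ allBelow Y j) ≡ gauss (d ℕ.∸ j) j ^ suc t
  ∑-allBelow {d} {j} {Y} hY j≤d = begin
    ∑ tuples (𝟙 ∘ allBelow Y j)
      ≡⟨ ∑-cong tuples (𝟙-allV-zipWith (λ S → below S j) Y) ⟩
    ∑ tuples (λ Z → ∏ (zipWith (λ S S′ → 𝟙 (below S j S′)) Y Z))
      ≡⟨ ∑-allVecs-∏ (allSubsets n) _ Y ⟩
    ∏ (Vec.map (λ S → ∑ (allSubsets n) (𝟙 ∘ below S j)) Y)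
      ≡⟨ ∏-const Y (λ i → ∑-below-gauss (subspaces hY i) (sizes hY i) j≤d) ⟩
    gauss (d ℕ.∸ j) j ^ suc t ∎

  -- The last two hypotheses say that `b` selects the tuples below `Y` of dimension less than `e`,
  -- on which `x` depends only on the dimension. Serves both the Möbius recursion and the count of
  -- the whole poset.
  ∑-by-dimension : {Y : Tuple} → HasDims Y d → ∀ e → (∀ j → j < e → j ≤ d) →
    (b : Tuple → Bool) (x : Tuple → ℤ) (f : ℕ → ℤ) →
    (∀ Z → b Z ≡ true → ∃ λ j → j < e × allBelow Y j Z ≡ true × x Z ≡ f j) →
    (∀ Z j → j < e → allBelow Y j Z ≡ true → b Z ≡ true) →
    ∑ tuples (λ Z → 𝟙 (b Z) * x Z) ≡ ∑ (upTo e) (λ j → gauss (d ℕ.∸ j) j ^ suc t * f j)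
  ∑-by-dimension {d} {Y} hY e e≤d b x f to from = begin
    ∑ tuples (λ Z → 𝟙 (b Z) * x Z)
      ≡⟨ ∑-cong tuples pointwise ⟩
    ∑ tuples (λ Z → ∑ (upTo e) (λ j → 𝟙 (allBelow Y j Z) * f j))
      ≡⟨ ∑-swap tuples (upTo e) _ ⟩
    ∑ (upTo e) (λ j → ∑ tuples (λ Z → 𝟙 (allBelow Y j Z) * f j))
      ≡⟨ ∑-cong (upTo e) (λ j → ∑-*ʳ tuples _ (f j)) ⟩
    ∑ (upTo e) (λ j → ∑ tuples (𝟙 ∘ allBelow Y j) * f j)
      ≡⟨ ∑-upTo-cong e (λ j j<e → cong (_* f j) (∑-allBelow hY (e≤d j j<e))) ⟩
    ∑ (upTo e) (λ j → gauss (d ℕ.∸ j) j ^ suc t * f j) ∎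
    where
    pointwise : ∀ Z → 𝟙 (b Z) * x Z ≡ ∑ (upTo e) (λ j → 𝟙 (allBelow Y j Z) * f j)
    pointwise Z with b Z in eq
    ... | false = trans (ℤₚ.*-zeroˡ (x Z)) (sym (∑-upTo-zero e absent))
      where
      absent : ∀ j → j < e → 𝟙 (allBelow Y j Z) * f j ≡ 0ℤ
      absent j j<e with allBelow Y j Z in p
      ... | false = ℤₚ.*-zeroˡ (f j)
      ... | true with () ← trans (sym (from Z j j<e p)) eq
    ... | true with j₀ , j₀<e , p₀ , xZ ← to Z eq = begin
      1ℤ * x Z
        ≡⟨ cong (1ℤ *_) xZ ⟩
      1ℤ * f j₀
        ≡⟨ cong (λ b → 𝟙 b * f j₀) p₀ ⟨
      𝟙 (allBelow Y j₀ Z) * f j₀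
        -- The dimension of a tuple is unique, so only `j₀` contributes.
        ≡⟨ ∑-upTo-select e _ j₀<e others ⟨
      ∑ (upTo e) (λ j → 𝟙 (allBelow Y j Z) * f j) ∎
      where
      others : ∀ j → j ≢ j₀ → 𝟙 (allBelow Y j Z) * f j ≡ 0ℤ
      others j j≢j₀ with allBelow Y j Z in p
      ... | false = ℤₚ.*-zeroˡ (f j)
      ... | true = contradiction (dims-unique (allBelow-dims Y j Z p) (allBelow-dims Y j₀ Z p₀)) j≢j₀

  lookup-⊤ : ∀ i v → lookup ⊤ᴮ i v ≡ true
  lookup-⊤ i v = cong (λ S → S v) (Vecₚ.lookup-replicate i (λ _ → true))

  lookup-⊥ : ∀ i v → lookup ⊥ᴮ i v ≡ v ==ᵛ zeroV
  lookup-⊥ i v = cong (λ S → S v) (Vecₚ.lookup-replicate i (λ v → v ==ᵛ zeroV))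

  ⊥ᴮ-elim : ∀ i v → lookup ⊥ᴮ i v ≡ true → v ≡ zeroV
  ⊥ᴮ-elim i v e = ==ᵛ-elim (trans (sym (lookup-⊥ i v)) e)

  ⊥ᴮ-intro : ∀ i v → v ≡ zeroV → lookup ⊥ᴮ i v ≡ true
  ⊥ᴮ-intro i v e = trans (lookup-⊥ i v) (==ᵛ-intro e)

  ⊤-dims : HasDims ⊤ᴮ n
  ⊤-dims = dims
    (λ i → record { has-zero = lookup-⊤ i _ ; has-⊕ = λ _ _ _ _ → lookup-⊤ i _ ; has-· = λ _ _ _ → lookup-⊤ i _ })
    (λ i → trans (∑-cong (vecs n) (λ v → cong 𝟙 (lookup-⊤ i v))) (∑-vecs-1 n))

  ⊥-dims : HasDims ⊥ᴮ 0
  ⊥-dims = dims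
    (λ i → record
      { has-zero = ⊥ᴮ-intro i _ refl
      ; has-⊕    = λ u v p r → ⊥ᴮ-intro i _ (trans (cong₂ _⊕_ (⊥ᴮ-elim i u p) (⊥ᴮ-elim i v r)) (⊕-identityˡ zeroV))
      ; has-·    = λ a v p → ⊥ᴮ-intro i _ (trans (cong (a ·_) (⊥ᴮ-elim i v p)) (·-zeroʳ a))
      })
    (λ i → trans
      (∑-cong (vecs n) (λ v → cong 𝟙 (bool-ext (λ e → ==ᵛ-intro (sym (⊥ᴮ-elim i v e))) (λ e → ⊥ᴮ-intro i v (sym (==ᵛ-elim e))))))
      (∑-𝟙-==ᵛ (zeroV {n})))

  ≤⊤ : (Z : Tuple) → Z ≤ᴮ ⊤ᴮ ≡ true
  ≤⊤ Z = ≤ᴮ-intro Z ⊤ᴮ (λ i v _ → lookup-⊤ i v)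

  ⊥≤ : {Y : Tuple} → HasDims Y d → ⊥ᴮ ≤ᴮ Y ≡ true
  ⊥≤ {Y = Y} hY = ≤ᴮ-intro ⊥ᴮ Y (λ i v e →
    subst (λ v → lookup Y i v ≡ true) (sym (⊥ᴮ-elim i v e)) (Subspace.has-zero (subspaces hY i)))

  strictlyBetween : Tuple → Tuple → Bool
  strictlyBetween Y Z = (⊥ᴮ ≤ᴮ Z) ∧ (Z <ᵇ Y)

  μ-value : ℕ → ℤ
  μ-value d = -1ℤ ^ d * total d

  -- Solves `total-recurrence` for its last term, whose coefficient is the binomial [d + 1, d + 1] =
  -- 1.
  μ-value-recurrence : ∀ d → - ∑ (upTo (suc d)) (λ j → gauss (suc d ℕ.∸ j) j ^ suc t * μ-value j) ≡ μ-value (suc d)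
  μ-value-recurrence d = begin
    - s
      ≡⟨ solveFor s (μ-value (suc d)) (begin
           s + μ-value (suc d)
             ≡⟨ cong (_+_ s) last ⟨
           s + gauss (suc d ℕ.∸ suc d) (suc d) ^ suc t * μ-value (suc d)
             ≡⟨ ∑-upTo-last (suc d) _ ⟨
           ∑ (upTo (suc (suc d))) (λ j → gauss (suc d ℕ.∸ j) j ^ suc t * μ-value j)
             ≡⟨ ∑-cong (upTo (suc (suc d))) (λ j → rearrange (gauss (suc d ℕ.∸ j) j ^ suc t) (-1ℤ ^ j) (total j)) ⟩
           ∑ (upTo (suc (suc d))) (λ j → -1ℤ ^ j * term (suc d ℕ.∸ j) j)
             ≡⟨ total-recurrence d ⟩
           0ℤ ∎) ⟩
    μ-value (suc d) ∎
    where
    s : ℤ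
    s = ∑ (upTo (suc d)) (λ j → gauss (suc d ℕ.∸ j) j ^ suc t * μ-value j)
    last : gauss (d ℕ.∸ d) (suc d) ^ suc t * μ-value (suc d) ≡ μ-value (suc d)
    last = trans (cong (λ m → gauss m (suc d) ^ suc t * μ-value (suc d)) (ℕₚ.n∸n≡0 d))
      (trans (cong (_* μ-value (suc d)) (ℤₚ.^-zeroˡ (suc t))) (ℤₚ.*-identityˡ _))
    rearrange : ∀ a b c → a * (b * c) ≡ b * (c * a)
    rearrange = solve-∀
    solveFor : ∀ s x → s + x ≡ 0ℤ → - s ≡ x
    solveFor s x e = trans (sym (ℤₚ.+-identityʳ (- s))) (trans (cong (_+_ (- s)) (sym e)) (cancel s x))
      where
      cancel : ∀ s x → - s + (s + x) ≡ x
      cancel = solve-∀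

  -- Each recursive call is on an element of smaller dimension, so fuel above the dimension never
  -- runs out. The bound `d ≤ n` keeps the dimensions within the range searched by `isElem`.
  μ-fuel-value : ∀ k d {Y : Tuple} → d < k → d ≤ n → HasDims Y d → μ-fuel k ⊥ᴮ Y ≡ μ-value d
  μ-fuel-value (suc k) zero {Y} d<k d≤n hY
    rewrite ⊥≤ hY | ≥ᴮ-of-dims ⊥-dims hY (⊥≤ hY) = refl
  μ-fuel-value (suc k) (suc d) {Y} (s≤s d<k) d≤n hY with Y ≤ᴮ ⊥ᴮ in eq
  ... | true = contradiction (dims-mono hY ⊥-dims eq) λ ()
  ... | false rewrite ⊥≤ hY = begin
    - sumℤ (map (μ-fuel k ⊥ᴮ) (filter (λ Z → strictlyBetween Y Z Bool.≟ true) (elems n (suc t))))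
      ≡⟨ cong -_ (∑-sumℤ (filter (λ Z → strictlyBetween Y Z Bool.≟ true) (elems n (suc t))) _) ⟩
    - ∑ (filter (λ Z → strictlyBetween Y Z Bool.≟ true) (elems n (suc t))) (μ-fuel k ⊥ᴮ)
      ≡⟨ cong -_ (trans (∑-filter-true (strictlyBetween Y) (elems n (suc t)) _) (∑-filter-true isElem tuples _)) ⟩
    - ∑ tuples (λ Z → 𝟙 (isElem Z) * (𝟙 (strictlyBetween Y Z) * μ-fuel k ⊥ᴮ Z))
      ≡⟨ cong -_ (∑-cong tuples (λ Z → trans (sym (ℤₚ.*-assoc (𝟙 (isElem Z)) _ _))
           (cong (_* μ-fuel k ⊥ᴮ Z) (sym (𝟙-∧ (isElem Z) (strictlyBetween Y Z)))))) ⟩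
    - ∑ tuples (λ Z → 𝟙 (isElem Z ∧ strictlyBetween Y Z) * μ-fuel k ⊥ᴮ Z)
      ≡⟨ cong -_ (∑-by-dimension hY (suc d) (λ j → ℕₚ.<⇒≤) _ _ μ-value to from) ⟩
    - ∑ (upTo (suc d)) (λ j → gauss (suc d ℕ.∸ j) j ^ suc t * μ-value j)
      ≡⟨ μ-value-recurrence d ⟩
    μ-value (suc d) ∎
    where
    to : ∀ Z → isElem Z ∧ strictlyBetween Y Z ≡ true →
      ∃ λ j → j < suc d × allBelow Y j Z ≡ true × μ-fuel k ⊥ᴮ Z ≡ μ-value j
    to Z p with e , u ← ∧-true {isElem Z} p
           with _ , w ← ∧-true {⊥ᴮ ≤ᴮ Z} u
           with Z≤Y , Y≰Z ← ∧-true {Z ≤ᴮ Y} w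
           with j , f ← isElem-elim Z e =
      j , j<1+d , allBelow-intro Y j Z f Z≤Y ,
      μ-fuel-value k j (ℕₚ.<-≤-trans j<1+d d<k) (ℕₚ.≤-trans (ℕₚ.<⇒≤ j<1+d) d≤n) hZ
      where
      hZ : HasDims Z j
      hZ = hasDims Z j f
      j<1+d : j < suc d
      -- In equal dimension `Z ≤ Y` would force `Y ≤ Z`.
      j<1+d = ℕₚ.≤∧≢⇒< (dims-mono hZ hY Z≤Y) (λ { refl → not-elim Y≰Z (≥ᴮ-of-dims hZ hY Z≤Y) })
    from : ∀ Z j → j < suc d → allBelow Y j Z ≡ true → isElem Z ∧ strictlyBetween Y Z ≡ true
    from Z j j<1+d b with f , Z≤Y ← allBelow-elim Y j Z b = ∧-intro
      (isElem-intro Z (ℕₚ.≤-trans (ℕₚ.<⇒≤ j<1+d) d≤n) f)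
      (∧-intro (⊥≤ hZ) (∧-intro Z≤Y (not-intro (λ Y≤Z → ℕₚ.<⇒≱ j<1+d (dims-mono hY hZ Y≤Z)))))
      where
      hZ : HasDims Z j
      hZ = allBelow-dims Y j Z b

  -- The elements of dimension `j` number `gauss (n ∸ j) j ^ suc t`, which is nonzero for each of
  -- the `n + 1` dimensions.
  n<length-elems : n < length (elems n (suc t))
  n<length-elems = ℤₚ.drop‿+≤+ (ℤₚ.≤-trans (∑-upTo-lower (suc n) positive) (ℤₚ.≤-reflexive (sym total-count)))
    where
    total-count : + length (elems n (suc t)) ≡ ∑ (upTo (suc n)) (λ j → gauss (n ℕ.∸ j) j ^ suc t * 1ℤ)
    total-count = begin
      + length (elems n (suc t))
        ≡⟨ ∑-length (elems n (suc t)) ⟨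
      ∑ (elems n (suc t)) (λ _ → 1ℤ)
        ≡⟨ ∑-filter-true isElem tuples _ ⟩
      ∑ tuples (λ Z → 𝟙 (isElem Z) * 1ℤ)
        ≡⟨ ∑-by-dimension ⊤-dims (suc n) (λ j → ℕₚ.≤-pred) isElem _ (λ _ → 1ℤ) to from ⟩
      ∑ (upTo (suc n)) (λ j → gauss (n ℕ.∸ j) j ^ suc t * 1ℤ) ∎
      where
      to : ∀ Z → isElem Z ≡ true → ∃ λ j → j < suc n × allBelow ⊤ᴮ j Z ≡ true × 1ℤ ≡ 1ℤ
      to Z e with j , f ← isElem-elim Z e =
        j , s≤s (dims-mono (hasDims Z j f) ⊤-dims (≤⊤ Z)) , allBelow-intro ⊤ᴮ j Z f (≤⊤ Z) , refl
      from : ∀ Z j → j < suc n → allBelow ⊤ᴮ j Z ≡ true → isElem Z ≡ true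
      from Z j (s≤s j≤n) b = isElem-intro Z j≤n (proj₁ (allBelow-elim ⊤ᴮ j Z b))
    gauss-nonzero : j ≤ n → gauss (n ℕ.∸ j) j ≢ 0ℤ
    gauss-nonzero {j} j≤n e = frames-nonzero j≤n (begin
      frames n j                        ≡⟨ cong (λ d → frames d j) (ℕₚ.m+[n∸m]≡n j≤n) ⟨
      frames (j ℕ.+ (n ℕ.∸ j)) j        ≡⟨ gauss-frames (n ℕ.∸ j) j ⟨
      gauss (n ℕ.∸ j) j * frames j j    ≡⟨ cong (_* frames j j) e ⟩
      0ℤ * frames j j                   ≡⟨ ℤₚ.*-zeroˡ (frames j j) ⟩
      0ℤ                                ∎)
    positive : ∀ j → j < suc n → 1ℤ ℤ.≤ gauss (n ℕ.∸ j) j ^ suc t * 1ℤ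
    positive j (s≤s j≤n) = subst (1ℤ ℤ.≤_)
      (trans count (sym (ℤₚ.*-identityʳ _)))
      -- As a value of `countL` the power is a natural number, so being nonzero makes it at least 1.
      (ℤ.+≤+ (ℕₚ.n≢0⇒n>0 (λ c≡0 → gauss-nonzero j≤n
        (ℤₚ.i^n≡0⇒i≡0 _ (suc t) (trans (sym count) (cong +_ c≡0))))))
      where
      count : + countL (allBelow ⊤ᴮ j) tuples ≡ gauss (n ℕ.∸ j) j ^ suc t
      count = trans (countL-∑ (allBelow ⊤ᴮ j) tuples) (∑-allBelow ⊤-dims j≤n)

  möbiusNumber-value : möbiusNumber n (suc t) ≡ μ-value n
  möbiusNumber-value = μ-fuel-value (length (elems n (suc t))) n n<length-elems ℕₚ.≤-refl ⊤-dims

-- The sign `-1ℤ ^ n` equals that with exponent `n - 2`, which would be negative at `n = 1`.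
theorem6p5 : (q : ℕ) (F : FiniteField q) (t n : ℕ) → 1 ≤ t → 1 ≤ n →
    LinAlg.möbiusNumber F n t ≡ (-1ℤ ^ n) * (+ W n t q)
theorem6p5 q F (suc t) (suc n) _ _ = trans (MöbiusFunction.möbiusNumber-value F (suc n) t)
  (cong (-1ℤ ^ suc n *_) (sym (Permutations.W-total q (suc t) n)))
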